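{- (i) There exists a positive integer $s$ such that for all graphs $G,H$ having the $s$-extension property, if each of the sentences $\varphi^1_C,\varphi^2_C,\varphi^3_C,\varphi^1_I,\varphi^2_I,\varphi^3_I$ does not differ between $G$ and $H$ (that is, it is true on both or false on both), then no sentence $\varphi\in\mathcal{E}_1^2$ differs between $G$ and $H$. (ii) For every positive integer $s$ and every $$\varphi\in\{\varphi^1_C,\ \neg\varphi^1_C\wedge\neg\varphi^2_C\wedge\varphi^3_C,\ \neg\varphi^1_C\wedge\neg\varphi^2_C\wedge\neg\varphi^3_C,\ \varphi^2_C\wedge\varphi^3_C,\ \varphi^2_C\wedge\neg\varphi^3_C\},$$ there exists a graph $G$ with the $s$-extension property such that $G\models\varphi$; and the same holds with $\varphi^1_C,\varphi^2_C,\varphi^3_C$ replaced by $\varphi^1_I,\varphi^2_I,\varphi^3_I$ respectively.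
   Context: Graphs are finite undirected simple graphs; sentences use relations $\sim$ (adjacency) and $=$. A graph has the $s$-extension property if for every set $S$ of $s$ distinct vertices and every subset $T\subseteq S$ (possibly empty) there is a vertex $z\notin S$ adjacent to every vertex of $T$ and non-adjacent to every vertex of $S\setminus T$. $\mathcal{E}_1^2$ is the class of sentences $\exists X\,\phi(X)$ with a single monadic variable $X$ (ranging over vertex subsets) and $\phi(X)$ a first order sentence in $\sim,=,X$ of quantifier depth 2. Define formulas of a set variable $X$: $\mathrm{cl}(X)$: any two distinct vertices of $X$ are adjacent; $\max\mathrm{cl}(X)$: $\mathrm{cl}(X)$ holds and there is no vertex outside $X$ adjacent to all vertices of $X$; $\varphi_C(X)$: there is a vertex outside $X$ adjacent to no vertex of $X$; $\mathrm{ind}(X)$: no two vertices of $X$ are adjacent; $\max\mathrm{ind}(X)$: $\mathrm{ind}(X)$ holds and there is no vertex outside $X$ adjacent to no vertex of $X$; $\varphi_I(X)$: there is a vertex outside $X$ adjacent to every vertex of $X$. Then $\varphi^1_C=\forall X[\mathrm{cl}(X)\to\varphi_C(X)]$, $\varphi^2_C=\forall X[\max\mathrm{cl}(X)\to\neg\varphi_C(X)]$, $\varphi^3_C=\forall X[(\mathrm{cl}(X)\wedge\neg\varphi_C(X))\to\max\mathrm{cl}(X)]$, and $\varphi^1_I=\forall X[\mathrm{ind}(X)\to\varphi_I(X)]$, $\varphi^2_I=\forall X[\max\mathrm{ind}(X)\to\neg\varphi_I(X)]$, $\varphi^3_I=\forall X[(\mathrm{ind}(X)\wedge\neg\varphi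_I(X))\to\max\mathrm{ind}(X)]$.
   Formalization: The s-extension property here also requires at least s vertices; otherwise graphs with fewer than s vertices have it vacuously and (i) fails (for s ≥ 4, K₂ and K₃ agree on all six sentences but differ on a sentence of the class). -}

module Defs where

open import Data.Bool using (Bool; false; T)
open import Data.Fin using (Fin)
open import Data.Fin.Patterns using (0F; 1F)
open import Data.Fin.Subset using (Subset; _∈_; _∉_; _⊆_; ∣_∣)
open import Data.List using (List; []; _∷_)
open import Data.Nat using (ℕ; suc; _≤_; _⊔_)
open import Data.Product using (Σ; ∃-syntax; _×_)
open import Data.Sum using (_⊎_)
open import Data.Vec as Vec using (Vec; lookup)
open import Relation.Binary.PropositionalEquality using (_≡_)
open import Relation.Nullary using (¬_)

record Graph : Set where
  field
    order  : ℕ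
    adj    : Fin order → Fin order → Bool
    symm   : ∀ x y → adj x y ≡ adj y x
    irrefl : ∀ x → adj x x ≡ false

  Vertex : Set
  Vertex = Fin order

  infix 4 _~_
  _~_ : Vertex → Vertex → Set
  x ~ y = T (adj x y)

-- The first conjunct excludes graphs with fewer than s vertices, for which
-- the second conjunct is vacuous.
ExtensionProperty : ℕ → Graph → Set
ExtensionProperty s G =
  s ≤ order ×
  (∀ (S : Subset order) → ∣ S ∣ ≡ s → ∀ (T : Subset order) → T ⊆ S →
    ∃[ z ] z ∉ S
         × (∀ x → x ∈ T → z ~ x)
         × (∀ x → x ∈ S → x ∉ T → ¬ (z ~ x)))
  where open Graph G

infix  8 _∼'_ _≈'_
infix  7 ¬'_
infixr 6 _∧'_
infixr 5 _∨'_
infixr 4 _⇒'_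
infix  3 ∀'_ ∃'_

-- First order formulas over ∼, = and one set variable X, with at most k free
-- first order variables, written as de Bruijn indices (0F is bound innermost).
data Formula (k : ℕ) : Set where
  _∼'_ _≈'_      : Fin k → Fin k → Formula k
  X'             : Fin k → Formula k
  ¬'_            : Formula k → Formula k
  _∧'_ _∨'_ _⇒'_ : Formula k → Formula k → Formula k
  ∀'_ ∃'_        : Formula (suc k) → Formula k

depth : ∀ {k} → Formula k → ℕ
depth (_ ∼' _) = 0
depth (_ ≈' _) = 0
depth (X' _)   = 0
depth (¬' φ)   = depth φ
depth (φ ∧' ψ) = depth φ ⊔ depth ψ
depth (φ ∨' ψ) = depth φ ⊔ depth ψ
depth (φ ⇒' ψ) = depth φ ⊔ depth ψ
depth (∀' φ)   = suc (depth φ)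
depth (∃' φ)   = suc (depth φ)

module _ (G : Graph) (X : Subset (Graph.order G)) where
  open Graph G

  Holds : ∀ {k} → Vec Vertex k → Formula k → Set
  Holds ρ (i ∼' j) = lookup ρ i ~ lookup ρ j
  Holds ρ (i ≈' j) = lookup ρ i ≡ lookup ρ j
  Holds ρ (X' i)   = lookup ρ i ∈ X
  Holds ρ (¬' φ)   = ¬ Holds ρ φ
  Holds ρ (φ ∧' ψ) = Holds ρ φ × Holds ρ ψ
  Holds ρ (φ ∨' ψ) = Holds ρ φ ⊎ Holds ρ ψ
  Holds ρ (φ ⇒' ψ) = Holds ρ φ → Holds ρ ψ
  Holds ρ (∀' φ)   = (x : Vertex) → Holds (x Vec.∷ ρ) φ
  Holds ρ (∃' φ)   = Σ Vertex λ x → Holds (x Vec.∷ ρ) φ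

infix  7 ¬ˢ_
infixr 6 _∧ˢ_
infix  4 _⊨_

-- The fragment of monadic second order logic used here: Boolean combinations
-- of sentences with a single leading set quantifier.
data Sentence : Set where
  ∀X ∃X : Formula 0 → Sentence
  ¬ˢ_   : Sentence → Sentence
  _∧ˢ_  : Sentence → Sentence → Sentence

_⊨_ : Graph → Sentence → Set
G ⊨ ∀X φ     = (X : Subset (Graph.order G)) → Holds G X Vec.[] φ
G ⊨ ∃X φ     = Σ (Subset (Graph.order G)) λ X → Holds G X Vec.[] φ
G ⊨ ¬ˢ φ     = ¬ (G ⊨ φ)
G ⊨ (φ ∧ˢ ψ) = (G ⊨ φ) × (G ⊨ ψ)

𝓔₁² : Sentence → Set
𝓔₁² φ = ∃[ ψ ] φ ≡ ∃X ψ × depth ψ ≡ 2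

SameTruth : Graph → Graph → Sentence → Set
SameTruth G H φ = ((G ⊨ φ) × (H ⊨ φ)) ⊎ (¬ (G ⊨ φ) × ¬ (H ⊨ φ))

cl maxcl φC ind maxind φI : Formula 0
cl     = ∀' ∀' (X' 1F ∧' X' 0F ∧' ¬' (1F ≈' 0F) ⇒' 1F ∼' 0F)
maxcl  = cl ∧' ¬' (∃' (¬' X' 0F ∧' (∀' (X' 0F ⇒' 1F ∼' 0F))))
φC     = ∃' (¬' X' 0F ∧' (∀' (X' 0F ⇒' ¬' (1F ∼' 0F))))
ind    = ∀' ∀' (X' 1F ∧' X' 0F ∧' ¬' (1F ≈' 0F) ⇒' ¬' (1F ∼' 0F))
maxind = ind ∧' ¬' (∃' (¬' X' 0F ∧' (∀' (X' 0F ⇒' ¬' (1F ∼' 0F)))))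
φI     = ∃' (¬' X' 0F ∧' (∀' (X' 0F ⇒' 1F ∼' 0F)))

φ¹C φ²C φ³C φ¹I φ²I φ³I : Sentence
φ¹C = ∀X (cl ⇒' φC)
φ²C = ∀X (maxcl ⇒' ¬' φC)
φ³C = ∀X (cl ∧' ¬' φC ⇒' maxcl)
φ¹I = ∀X (ind ⇒' φI)
φ²I = ∀X (maxind ⇒' ¬' φI)
φ³I = ∀X (ind ∧' ¬' φI ⇒' maxind)

combinations : (φ¹ φ² φ³ : Sentence) → List Sentence
combinations φ¹ φ² φ³ =
    φ¹
  ∷ (¬ˢ φ¹ ∧ˢ ¬ˢ φ² ∧ˢ φ³)
  ∷ (¬ˢ φ¹ ∧ˢ ¬ˢ φ² ∧ˢ ¬ˢ φ³)
  ∷ (φ² ∧ˢ φ³)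
  ∷ (φ² ∧ˢ ¬ˢ φ³)
  ∷ []

{-# OPTIONS --safe #-}
-- (i) By the two-round Ehrenfeucht–Fraïssé game it is enough to find, for every
-- set X in G, a set Y in H realising the same vertex types, where the type of v
-- records whether v ∈ X and which combinations (in X or not, adjacent to v or
-- not) occur among the other vertices. The extension property leaves few
-- possible sets of types, up to complementing X and the graph: X empty, a
-- singleton, a neighbourhood, or a set all of whose types see everything
-- outside X. Each is realised in every graph with the 5-extension property,
-- except those where X is a clique (or an independent set) that is maximal or
-- dominating; the existence of these is what the six sentences determine.
--
-- (ii) Take a generic relation g and give each vertex v a colour col v and a
-- second colour π v. Join x and y if they have different colours and π x = col y,
-- π y = col x or g x y. Every maximal clique then meets each colour exactly once,
-- and whether a clique dominates depends only on its colours and its π; the five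
-- cases arise from five restrictions on the pairs (col v, π v). A generic g is
-- built by hashing: a vertex stores a list of tests, a table indexed by the
-- results of these tests, and the number of the part of the table it uses;
-- g x y is the xor of the entry of x selected by y and the entry of y selected by
-- x. A new vertex chooses tests separating the given vertices and a part of its
-- table that they do not inspect, so the entries it needs can be set freely.
module Submission where

open import Data.Bool as Bool using (Bool; true; false; not; T; T?; _xor_; if_then_else_)
open import Data.Bool.Properties using (T-≡; ¬-not; not-¬; not-involutive; not-injective; xor-comm; xor-assoc; xor-same; xor-identityʳ)
open import Data.Empty using (⊥-elim)
open import Data.Fin using (Fin; zero; suc; funToFin; finToFun; remQuot; combine)
open import Data.Fin.Patterns using (0F; 1F; 2F)
open import Data.Fin.Properties using (_≟_; any?; all?; +↔⊎; *↔×; 1↔⊤; 2↔Bool; injective⇒≤; finToFun-funToFin; funToFin-finToFin; remQuot-combine)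
open import Data.Fin.Subset using (Subset; inside; outside; ∣_∣; _⊆_; _∩_) renaming (_∈_ to _∈ˢ_; _∉_ to _∉ˢ_)
open import Data.Fin.Subset.Properties using (anySubset?; _∈?_; p∩q⊆p; x∈p∩q⁺; x∈p∩q⁻)
open import Data.List as List using (List; []; _∷_; length; map; _++_; allFin; filter)
open import Data.List.Properties using (length-map; length-++; length-tabulate)
open import Data.List.Membership.Propositional using (_∈_; _∉_)
open import Data.List.Membership.Propositional.Properties using (∈-map⁺; ∈-++⁺ˡ; ∈-++⁺ʳ; ∈-allFin; ∈-filter⁺; ∈-filter⁻; ∈-tabulate⁺)
import Data.List.Membership.DecPropositional as DecMem
open import Data.List.Relation.Unary.All as All using (All; []; _∷_)
open import Data.List.Relation.Unary.AllPairs using (AllPairs; []; _∷_)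
open import Data.List.Relation.Unary.Any as Any using (Any; here; there)
open import Data.List.Relation.Unary.Any.Properties using (lookup-index)
open import Data.Nat using (ℕ; zero; suc; _+_; _*_; _^_; _≤_; _<_; _≤?_; z≤n; s≤s)
open import Data.Nat.Properties using (≤-refl; ≤-trans; ≤-reflexive; ≤-antisym; ≰⇒>; <⇒≱; n≤1+n; 1+n≰n; m≤m+n; m⊔n≤o⇒m≤o; m⊔n≤o⇒n≤o)
open import Data.Product as Product using (∃; ∃-syntax; _×_; _,_; proj₁; proj₂)
open import Data.Product.Function.NonDependent.Propositional using (_×-↔_)
open import Data.Product.Properties using (≡-dec)
open import Data.Sum as Sum using (_⊎_; inj₁; inj₂; [_,_]′)
open import Data.Sum.Function.Propositional using (_⊎-↔_)
open import Data.Unit using (⊤; tt)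
open import Data.Vec as Vec using (Vec; lookup; tabulate; []; _∷_; here; there)
open import Data.Vec.Properties using (lookup⇒[]=; []=⇒lookup; lookup∘tabulate)
open import Function using (_∘_; id; case_of_)
open import Function.Bundles using (Equivalence; Inverse; _⇔_; _↔_; mk⇔)
open import Function.Construct.Composition using (_↔-∘_)
open import Function.Construct.Identity using (↔-id)
open import Relation.Binary.PropositionalEquality
open import Relation.Nullary using (¬_; Dec; yes; no; does; proof; contradiction; Reflects; ofʸ; ofⁿ)
open import Relation.Nullary.Decidable using (_×-dec_; _⊎-dec_; _→-dec_; ¬?; decidable-stable; dec-true; dec-false; map′; toSum)
open import Defs

open Graph using (order; adj; Vertex)

-- Decidability of satisfaction

module _ (G : Graph) (X : Subset (order G)) where
  open Graph G using (_~_)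

  holds? : ∀ {k} (ρ : Vec (Vertex G) k) (φ : Formula k) → Dec (Holds G X ρ φ)
  holds? ρ (i ∼' j) = T? _
  holds? ρ (i ≈' j) = lookup ρ i ≟ lookup ρ j
  holds? ρ (X' i)   = lookup ρ i ∈? X
  holds? ρ (¬' φ)   = ¬? (holds? ρ φ)
  holds? ρ (φ ∧' ψ) = holds? ρ φ ×-dec holds? ρ ψ
  holds? ρ (φ ∨' ψ) = holds? ρ φ ⊎-dec holds? ρ ψ
  holds? ρ (φ ⇒' ψ) = holds? ρ φ →-dec holds? ρ ψ
  holds? ρ (∀' φ)   = all? λ x → holds? (x ∷ ρ) φ
  holds? ρ (∃' φ)   = any? λ x → holds? (x ∷ ρ) φ

∃X? : ∀ G φ → Dec (G ⊨ ∃X φ)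
∃X? G φ = anySubset? λ X → holds? G X [] φ

-- A finite graph has finitely many vertex sets and satisfaction is decidable, so an exhaustive
-- search extracts an explicit set from a mere negation.
counterexample : ∀ G φ → ¬ (G ⊨ ∀X φ) → ∃[ X ] ¬ Holds G X [] φ
counterexample G φ ¬∀ with anySubset? (λ X → ¬? (holds? G X [] φ))
... | yes p = p
... | no ¬p = contradiction (λ X → decidable-stable (holds? G X [] φ) λ ¬h → ¬p (X , ¬h)) ¬∀

-- Sets of vertices are handled as Boolean functions.

∈ˢ⇒≡ : ∀ {n} {X : Subset n} {x} → x ∈ˢ X → lookup X x ≡ true
∈ˢ⇒≡ = []=⇒lookup

≡⇒∈ˢ : ∀ {n} {X : Subset n} {x} → lookup X x ≡ true → x ∈ˢ X
≡⇒∈ˢ {X = X} {x} = lookup⇒[]= x X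

∉ˢ⇒≡ : ∀ {n} {X : Subset n} {x} → x ∉ˢ X → lookup X x ≡ false
∉ˢ⇒≡ x∉X = ¬-not (x∉X ∘ ≡⇒∈ˢ)

≡⇒∉ˢ : ∀ {n} {X : Subset n} {x} → lookup X x ≡ false → x ∉ˢ X
≡⇒∉ˢ eq x∈X with trans (sym eq) (∈ˢ⇒≡ x∈X)
... | ()

T⇒≡ : ∀ {b} → T b → b ≡ true
T⇒≡ = Equivalence.to T-≡

≡⇒T : ∀ {b} → b ≡ true → T b
≡⇒T = Equivalence.from T-≡

¬T⇒≡ : ∀ {b} → ¬ T b → b ≡ false
¬T⇒≡ ¬t = ¬-not (¬t ∘ ≡⇒T)

≡⇒¬T : ∀ {b} → b ≡ false → ¬ T b
≡⇒¬T refl ()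

true≢false : true ≢ false
true≢false ()

clash : ∀ {a} {A : Set a} {b c : Bool} → b ≡ c → b ≡ not c → A
clash {c = true} refl ()
clash {c = false} refl ()

-- Cliques, independent sets and the six sentences

module _ (G : Graph) where

  Clique : Bool → (Vertex G → Bool) → Set
  Clique d P = ∀ {x y} → P x ≡ true → P y ≡ true → x ≢ y → adj G x y ≡ d

  -- For `Clique d P`, the property `Out d P` says that `P` is not maximal, and `Out (not d) P` that
  -- `P` does not dominate the graph.
  Out : Bool → (Vertex G → Bool) → Set
  Out e P = ∃[ z ] P z ≡ false × (∀ x → P x ≡ true → adj G z x ≡ e)

  Sees : (Vertex G → Bool) → Vertex G → Bool → Bool → Set
  Sees P v a d = ∃[ u ] u ≢ v × P u ≡ a × adj G v u ≡ d

-- The parameter d is true for the sentences about cliques and false for those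
-- about independent sets.
cliqueF outF : Bool → Formula 0
cliqueF true  = cl
cliqueF false = ind
outF true  = φI
outF false = φC

-- `maxcl` unfolds to `cl` and the negation of `φI`, and dually for `maxind`. Hence at `true` and
-- `false` these are the six sentences of the theorem by computation.
φ¹ φ² φ³ : Bool → Sentence
φ¹ d = ∀X (cliqueF d ⇒' outF (not d))
φ² d = ∀X ((cliqueF d ∧' ¬' outF d) ⇒' ¬' outF (not d))
φ³ d = ∀X ((cliqueF d ∧' ¬' outF (not d)) ⇒' (cliqueF d ∧' ¬' outF d))

module _ {G : Graph} {X : Subset (order G)} where

  holds⇒clique : ∀ d → Holds G X [] (cliqueF d) → Clique G d (lookup X)
  holds⇒clique true  h p q r = T⇒≡ (h _ _ (≡⇒∈ˢ p , ≡⇒∈ˢ q , r))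
  holds⇒clique false h p q r = ¬T⇒≡ (h _ _ (≡⇒∈ˢ p , ≡⇒∈ˢ q , r))

  clique⇒holds : ∀ d → Clique G d (lookup X) → Holds G X [] (cliqueF d)
  clique⇒holds true  c _ _ (p , q , r) = ≡⇒T (c (∈ˢ⇒≡ p) (∈ˢ⇒≡ q) r)
  clique⇒holds false c _ _ (p , q , r) = ≡⇒¬T (c (∈ˢ⇒≡ p) (∈ˢ⇒≡ q) r)

  holds⇒out : ∀ e → Holds G X [] (outF e) → Out G e (lookup X)
  holds⇒out true  (z , p , h) = z , ∉ˢ⇒≡ p , λ x q → T⇒≡ (h x (≡⇒∈ˢ q))
  holds⇒out false (z , p , h) = z , ∉ˢ⇒≡ p , λ x q → ¬T⇒≡ (h x (≡⇒∈ˢ q))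

  out⇒holds : ∀ e → Out G e (lookup X) → Holds G X [] (outF e)
  out⇒holds true  (z , p , h) = z , ≡⇒∉ˢ p , λ x q → ≡⇒T (h x (∈ˢ⇒≡ q))
  out⇒holds false (z , p , h) = z , ≡⇒∉ˢ p , λ x q → ≡⇒¬T (h x (∈ˢ⇒≡ q))

  out? : ∀ e → Dec (Out G e (lookup X))
  out? e with holds? G X [] (outF e)
  ... | yes h = yes (holds⇒out e h)
  ... | no ¬h = no (¬h ∘ out⇒holds e)

module _ (G : Graph) (d : Bool) where

  ⊨φ¹ : (∀ X → Clique G d (lookup X) → Out G (not d) (lookup X)) → G ⊨ φ¹ d
  ⊨φ¹ h X c = out⇒holds (not d) (h X (holds⇒clique d c))

  ⊨φ² : (∀ X → Clique G d (lookup X) → ¬ Out G d (lookup X) → ¬ Out G (not d) (lookup X)) → G ⊨ φ² d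
  ⊨φ² h X (c , n) o = h X (holds⇒clique d c) (n ∘ out⇒holds d) (holds⇒out (not d) o)

  ⊨φ³ : (∀ X → Clique G d (lookup X) → ¬ Out G (not d) (lookup X) → ¬ Out G d (lookup X)) → G ⊨ φ³ d
  ⊨φ³ h X (c , n) = c , h X (holds⇒clique d c) (n ∘ out⇒holds (not d)) ∘ holds⇒out d

  ⊭φ¹ : ∀ X → Clique G d (lookup X) → ¬ Out G (not d) (lookup X) → ¬ (G ⊨ φ¹ d)
  ⊭φ¹ X c n h = n (holds⇒out (not d) (h X (clique⇒holds d c)))

  ⊭φ² : ∀ X → Clique G d (lookup X) → ¬ Out G d (lookup X) → Out G (not d) (lookup X) → ¬ (G ⊨ φ² d)
  ⊭φ² X c n o h = h X (clique⇒holds d c , n ∘ holds⇒out d) (out⇒holds (not d) o)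

  ⊭φ³ : ∀ X → Clique G d (lookup X) → ¬ Out G (not d) (lookup X) → Out G d (lookup X) → ¬ (G ⊨ φ³ d)
  ⊭φ³ X c n o h = proj₂ (h X (clique⇒holds d c , n ∘ holds⇒out (not d))) (out⇒holds d o)

  -- A clique found in one graph refutes a sentence there. This lemma and the next two turn the
  -- refutation in the other graph back into a clique, which is how the six sentences carry cliques
  -- between graphs.
  ⊭φ¹⇒ : ¬ (G ⊨ φ¹ d) → ∃[ X ] Clique G d (lookup X) × ¬ Out G (not d) (lookup X)
  ⊭φ¹⇒ ¬φ with counterexample G (cliqueF d ⇒' outF (not d)) ¬φ
  ... | X , ¬h with holds? G X [] (cliqueF d)
  ...   | yes c = X , holds⇒clique d c , λ o → ¬h λ _ → out⇒holds (not d) o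
  ...   | no ¬c = contradiction (⊥-elim ∘ ¬c) ¬h

  ⊭φ²⇒ : ¬ (G ⊨ φ² d) →
         ∃[ X ] Clique G d (lookup X) × ¬ Out G d (lookup X) × Out G (not d) (lookup X)
  ⊭φ²⇒ ¬φ with counterexample G ((cliqueF d ∧' ¬' outF d) ⇒' ¬' outF (not d)) ¬φ
  ... | X , ¬h with holds? G X [] (cliqueF d) | holds? G X [] (outF (not d))
  ...   | no ¬c | _     = contradiction (⊥-elim ∘ ¬c ∘ proj₁) ¬h
  ...   | yes _ | no n  = contradiction (λ _ → n) ¬h
  ...   | yes c | yes o = X , holds⇒clique d c ,
    (λ o′ → ¬h λ (_ , n) → contradiction (out⇒holds d o′) n) , holds⇒out (not d) o

  ⊭φ³⇒ : ¬ (G ⊨ φ³ d) →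
         ∃[ X ] Clique G d (lookup X) × ¬ Out G (not d) (lookup X) × Out G d (lookup X)
  ⊭φ³⇒ ¬φ with counterexample G ((cliqueF d ∧' ¬' outF (not d)) ⇒' (cliqueF d ∧' ¬' outF d)) ¬φ
  ... | X , ¬h with holds? G X [] (cliqueF d) | holds? G X [] (outF d)
  ...   | no ¬c | _     = contradiction (⊥-elim ∘ ¬c ∘ proj₁) ¬h
  ...   | yes c | no n  = contradiction (λ _ → c , n) ¬h
  ...   | yes c | yes o = X , holds⇒clique d c ,
    (λ o′ → ¬h λ (_ , n) → contradiction (out⇒holds (not d) o′) n) , holds⇒out d o

-- Ehrenfeucht–Fraïssé games

module Game (G H : Graph) (X : Subset (order G)) (Y : Subset (order H)) where

  Atomic : ∀ {k} → Vec (Vertex G) k → Vec (Vertex H) k → Set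
  Atomic ρ σ = ∀ i → lookup X (lookup ρ i) ≡ lookup Y (lookup σ i)
    × (∀ j → adj G (lookup ρ i) (lookup ρ j) ≡ adj H (lookup σ i) (lookup σ j)
           × (lookup ρ i ≡ lookup ρ j ⇔ lookup σ i ≡ lookup σ j))

  -- The positions from which Duplicator survives `n` more rounds. `X` and `Y`, the moves for the
  -- set variable, are fixed beforehand.
  Sim : ℕ → ∀ {k} → Vec (Vertex G) k → Vec (Vertex H) k → Set
  Sim zero    ρ σ = Atomic ρ σ
  Sim (suc n) ρ σ = Atomic ρ σ
    × (∀ x → ∃[ y ] Sim n (x ∷ ρ) (y ∷ σ))
    × (∀ y → ∃[ x ] Sim n (x ∷ ρ) (y ∷ σ))

  atomic : ∀ n {k} {ρ : Vec _ k} {σ} → Sim n ρ σ → Atomic ρ σ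
  atomic zero    s = s
  atomic (suc n) s = proj₁ s

  -- Induction on the formula, where each quantifier uses up one round. Both directions are proved
  -- together because negation and implication exchange them.
  sim⇒⇔ : ∀ n {k} {ρ : Vec _ k} {σ} (φ : Formula k) → depth φ ≤ n → Sim n ρ σ →
          (Holds G X ρ φ → Holds H Y σ φ) × (Holds H Y σ φ → Holds G X ρ φ)
  sim⇒⇔ n (i ∼' j) _ s = subst T eq , subst T (sym eq)
    where eq = proj₁ (proj₂ (atomic n s i) j)
  sim⇒⇔ n (i ≈' j) _ s = Equivalence.to eq , Equivalence.from eq
    where eq = proj₂ (proj₂ (atomic n s i) j)
  sim⇒⇔ n (X' i) _ s =
    (λ p → ≡⇒∈ˢ (trans (sym eq) (∈ˢ⇒≡ p))) , (λ p → ≡⇒∈ˢ (trans eq (∈ˢ⇒≡ p)))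
    where eq = proj₁ (atomic n s i)
  sim⇒⇔ n (¬' φ) d s = (λ ¬h h → ¬h (proj₂ ih h)) , (λ ¬h h → ¬h (proj₁ ih h))
    where ih = sim⇒⇔ n φ d s
  sim⇒⇔ n (φ ∧' ψ) d s =
    (λ (h , k) → proj₁ ih h , proj₁ ik k) , (λ (h , k) → proj₂ ih h , proj₂ ik k)
    where ih = sim⇒⇔ n φ (m⊔n≤o⇒m≤o _ _ d) s
          ik = sim⇒⇔ n ψ (m⊔n≤o⇒n≤o (depth φ) _ d) s
  sim⇒⇔ n (φ ∨' ψ) d s = Sum.map (proj₁ ih) (proj₁ ik) , Sum.map (proj₂ ih) (proj₂ ik)
    where ih = sim⇒⇔ n φ (m⊔n≤o⇒m≤o _ _ d) s
          ik = sim⇒⇔ n ψ (m⊔n≤o⇒n≤o (depth φ) _ d) s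
  sim⇒⇔ n (φ ⇒' ψ) d s = (λ f → proj₁ ik ∘ f ∘ proj₂ ih) , (λ f → proj₂ ik ∘ f ∘ proj₁ ih)
    where ih = sim⇒⇔ n φ (m⊔n≤o⇒m≤o _ _ d) s
          ik = sim⇒⇔ n ψ (m⊔n≤o⇒n≤o (depth φ) _ d) s
  sim⇒⇔ (suc n) (∀' φ) (s≤s d) (_ , forth , back) =
    (λ h y → let x , s = back y in proj₁ (sim⇒⇔ n φ d s) (h x)) ,
    (λ h x → let y , s = forth x in proj₂ (sim⇒⇔ n φ d s) (h y))
  sim⇒⇔ (suc n) (∃' φ) (s≤s d) (_ , forth , back) =
    (λ (x , h) → let y , s = forth x in y , proj₁ (sim⇒⇔ n φ d s) h) ,
    (λ (y , h) → let x , s = back y in x , proj₂ (sim⇒⇔ n φ d s) h)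

module _ (G H : Graph) (P : Vertex G → Bool) (Q : Vertex H → Bool) where

  SameType : Vertex G → Vertex H → Set
  SameType v w = P v ≡ Q w × (∀ a d → Sees G P v a d → Sees H Q w a d)
                           × (∀ a d → Sees H Q w a d → Sees G P v a d)

  Match : Set
  Match = (∀ v → ∃[ w ] SameType v w) × (∀ w → ∃[ v ] SameType v w)

-- The second move either repeats the first vertex or picks another one with some membership and
-- some adjacency to it. These are the data that the types record.
match⇒sim : ∀ G H X Y → Match G H (lookup X) (lookup Y) → Game.Sim G H X Y 2 [] []
match⇒sim G H X Y (f , g) = (λ ()) ,
  (λ v → let w , t = f v in w , sim₁ t) , (λ w → let v , t = g w in v , sim₁ t)
  where
  open Game G H X Y
  noLoop : ∀ v w → adj G v v ≡ adj H w w
  noLoop v w = trans (Graph.irrefl G v) (sym (Graph.irrefl H w))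

  pair : ∀ {v w u u′} → lookup X v ≡ lookup Y w → lookup X u ≡ lookup Y u′ →
         adj G v u ≡ adj H w u′ → (u ≡ v ⇔ u′ ≡ w) → Atomic (u ∷ v ∷ []) (u′ ∷ w ∷ [])
  pair p q r e zero = q , λ
    { zero → noLoop _ _ , mk⇔ (λ _ → refl) (λ _ → refl)
    ; (suc zero) → trans (Graph.symm G _ _) (trans r (Graph.symm H _ _)) , e }
  pair p q r e (suc zero) = p , λ
    { zero → r , mk⇔ (sym ∘ Equivalence.to e ∘ sym) (sym ∘ Equivalence.from e ∘ sym)
    ; (suc zero) → noLoop _ _ , mk⇔ (λ _ → refl) (λ _ → refl) }

  sim₁ : ∀ {v w} → SameType G H (lookup X) (lookup Y) v w → Sim 1 (v ∷ []) (w ∷ [])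
  sim₁ {v} {w} (p , to , from) =
    (λ { zero → p , λ { zero → noLoop _ _ , mk⇔ (λ _ → refl) (λ _ → refl) } }) , forth , back
    where
    forth : ∀ u → ∃[ u′ ] Sim 0 (u ∷ v ∷ []) (u′ ∷ w ∷ [])
    forth u with u ≟ v
    ... | yes refl = w , pair p p (noLoop _ _) (mk⇔ (λ _ → refl) (λ _ → refl))
    ... | no u≢v with to _ _ (u , u≢v , refl , refl)
    ...   | u′ , u′≢w , q , r =
      u′ , pair p (sym q) (sym r) (mk⇔ (⊥-elim ∘ u≢v) (⊥-elim ∘ u′≢w))
    back : ∀ u′ → ∃[ u ] Sim 0 (u ∷ v ∷ []) (u′ ∷ w ∷ [])
    back u′ with u′ ≟ w
    ... | yes refl = v , pair p p (noLoop _ _) (mk⇔ (λ _ → refl) (λ _ → refl))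
    ... | no u′≢w with from _ _ (u′ , u′≢w , refl , refl)
    ...   | u , u≢v , q , r =
      u , pair p q r (mk⇔ (⊥-elim ∘ u≢v) (⊥-elim ∘ u′≢w))

-- The extension property for lists of vertices

fromList : ∀ {n} → List (Fin n) → Subset n
fromList []       = Vec.replicate _ outside
fromList (x ∷ xs) = fromList xs Vec.[ x ]≔ inside

∣[]≔∣ : ∀ {n} (S : Subset n) x → ∣ S Vec.[ x ]≔ inside ∣ ≤ suc ∣ S ∣
∣[]≔∣ (inside  ∷ S) zero    = n≤1+n _
∣[]≔∣ (outside ∷ S) zero    = ≤-refl
∣[]≔∣ (inside  ∷ S) (suc x) = s≤s (∣[]≔∣ S x)
∣[]≔∣ (outside ∷ S) (suc x) = ∣[]≔∣ S x

∈-[]≔ : ∀ {n} (S : Subset n) x → x ∈ˢ S Vec.[ x ]≔ inside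
∈-[]≔ (_ ∷ S) zero    = here
∈-[]≔ (_ ∷ S) (suc x) = there (∈-[]≔ S x)

⊆-[]≔ : ∀ {n} (S : Subset n) x → S ⊆ S Vec.[ x ]≔ inside
⊆-[]≔ (_ ∷ S) zero    here      = here
⊆-[]≔ (_ ∷ S) zero    (there p) = there p
⊆-[]≔ (_ ∷ S) (suc x) here      = here
⊆-[]≔ (_ ∷ S) (suc x) (there p) = there (⊆-[]≔ S x p)

∣fromList∣ : ∀ {n} (xs : List (Fin n)) → ∣ fromList xs ∣ ≤ length xs
∣fromList∣ {n} []       = ≤-reflexive (∣replicate∣ n)
  where
  ∣replicate∣ : ∀ n → ∣ Vec.replicate n outside ∣ ≡ 0
  ∣replicate∣ zero    = refl
  ∣replicate∣ (suc n) = ∣replicate∣ n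
∣fromList∣ (x ∷ xs) = ≤-trans (∣[]≔∣ (fromList xs) x) (s≤s (∣fromList∣ xs))

∈-fromList : ∀ {n} {xs : List (Fin n)} {x} → x ∈ xs → x ∈ˢ fromList xs
∈-fromList {xs = x ∷ xs} (here refl) = ∈-[]≔ (fromList xs) x
∈-fromList {xs = y ∷ xs} (there p)   = ⊆-[]≔ (fromList xs) y (∈-fromList p)

-- The extension property speaks only of sets of exactly `s` vertices, so smaller sets are padded.
enlarge : ∀ {n} s (S : Subset n) → ∣ S ∣ ≤ s → s ≤ n → ∃[ S′ ] S ⊆ S′ × ∣ S′ ∣ ≡ s
enlarge zero [] _ _ = [] , id , refl
enlarge {suc n} (suc s) (inside ∷ S) (s≤s p) (s≤s q) with enlarge s S p q
... | S′ , sub , eq = inside ∷ S′ , (λ { here → here ; (there x) → there (sub x) }) , cong suc eq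
enlarge {suc n} zero (outside ∷ S) p q with enlarge zero S p z≤n
... | S′ , sub , eq = outside ∷ S′ , (λ { (there x) → there (sub x) }) , eq
enlarge {suc n} (suc s) (outside ∷ S) p (s≤s q) with ∣ S ∣ ≤? s
... | yes r with enlarge s S r q
...   | S′ , sub , eq = inside ∷ S′ , (λ { (there x) → there (sub x) }) , cong suc eq
-- Here `S` has more than `s` members, hence exactly `suc s`, and nothing may be added.
enlarge {suc n} (suc s) (outside ∷ S) p (s≤s q) | no r =
  outside ∷ S , id , ≤-antisym p (≰⇒> r)

module Extension (G : Graph) {s} (E : ExtensionProperty s G) where

  -- The subset given to the extension property consists of those members of the padded set where
  -- `t` holds. Padding vertices obey `t` too, but the conclusion keeps only what concerns `xs`.
  extend : (xs : List (Vertex G)) → length xs ≤ s → (t : Vertex G → Bool) →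
           ∃[ z ] (∀ {x} → x ∈ xs → z ≢ x × adj G x z ≡ t x)
  extend xs len t with enlarge s (fromList xs) (≤-trans (∣fromList∣ xs) len) (proj₁ E)
  ... | S , sub , size with proj₂ E S size (S ∩ tabulate t) (p∩q⊆p S (tabulate t))
  ...   | z , z∉S , yesT , noT = z , λ {x} x∈xs →
    let x∈S = sub (∈-fromList x∈xs) in (λ { refl → z∉S x∈S }) , trans (Graph.symm G x z) (value x x∈S)
    where
    value : ∀ x → x ∈ˢ S → adj G z x ≡ t x
    value x x∈S with t x in eq
    ... | true  = T⇒≡ (yesT x (x∈p∩q⁺ (x∈S , ≡⇒∈ˢ (trans (lookup∘tabulate t x) eq))))
    ... | false = ¬T⇒≡ (noT x x∈S λ q → true≢false
      (trans (sym (∈ˢ⇒≡ (proj₂ (x∈p∩q⁻ S _ q)))) (trans (lookup∘tabulate t x) eq)))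

  assign : List (Vertex G × Bool) → Vertex G → Bool
  assign []             x = false
  assign ((y , b) ∷ cs) x = if does (x ≟ y) then b else assign cs x

  Distinct : List (Vertex G × Bool) → Set
  Distinct = AllPairs λ p q → proj₁ p ≢ proj₁ q

  assign-∈ : ∀ {cs x b} → Distinct cs → (x , b) ∈ cs → assign cs x ≡ b
  assign-∈ {(y , b) ∷ cs} (_ ∷ _) (here refl) rewrite dec-true (y ≟ y) refl = refl
  assign-∈ {(y , b) ∷ cs} {x} (y≢ ∷ ds) (there p)
    rewrite dec-false (x ≟ y) (λ x≡y → All.lookup y≢ p (sym x≡y)) = assign-∈ ds p

  -- The pairs in `cs` prescribe adjacencies, while the vertices in `us` are merely to be avoided.
  -- Distinctness makes the prescription consistent.
  witness : (cs : List (Vertex G × Bool)) (us : List (Vertex G)) → Distinct cs →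
            length cs + length us ≤ s →
            ∃[ z ] All (λ c → z ≢ proj₁ c × adj G (proj₁ c) z ≡ proj₂ c) cs × All (z ≢_) us
  witness cs us ds len with extend (map proj₁ cs ++ us) len′ (assign cs)
    where
    len′ : length (map proj₁ cs ++ us) ≤ s
    len′ = subst (_≤ s) (sym (trans (length-++ (map proj₁ cs)) (cong (_+ length us) (length-map proj₁ cs)))) len
  ... | z , h = z ,
    All.tabulate (λ c∈ → let p , q = h (∈-++⁺ˡ (∈-map⁺ proj₁ c∈)) in p , trans q (assign-∈ ds c∈)) ,
    All.tabulate (λ u∈ → proj₁ (h (∈-++⁺ʳ (map proj₁ cs) u∈)))

does-true : ∀ {A : Set} (A? : Dec A) → does A? ≡ true → A
does-true (yes a) _ = a

does-false : ∀ {A : Set} (A? : Dec A) → does A? ≡ false → ¬ A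
does-false (no ¬a) _ = ¬a

-- Kept abstract so that case analysis on a vertex does not unfold the set.
abstract
  ⟦_⟧ : ∀ {n} {D : Fin n → Set} → (∀ x → Dec (D x)) → Fin n → Bool
  ⟦ D? ⟧ x = does (D? x)

  ⟦⟧⁺ : ∀ {n} {D : Fin n → Set} (D? : ∀ x → Dec (D x)) {x} → D x → ⟦ D? ⟧ x ≡ true
  ⟦⟧⁺ D? {x} = dec-true (D? x)

  ⟦⟧⁻ : ∀ {n} {D : Fin n → Set} (D? : ∀ x → Dec (D x)) {x} → ⟦ D? ⟧ x ≡ true → D x
  ⟦⟧⁻ D? {x} = does-true (D? x)

  ¬⟦⟧⁺ : ∀ {n} {D : Fin n → Set} (D? : ∀ x → Dec (D x)) {x} → ¬ D x → ⟦ D? ⟧ x ≡ false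
  ¬⟦⟧⁺ D? {x} = dec-false (D? x)

  ¬⟦⟧⁻ : ∀ {n} {D : Fin n → Set} (D? : ∀ x → Dec (D x)) {x} → ⟦ D? ⟧ x ≡ false → ¬ D x
  ¬⟦⟧⁻ D? {x} = does-false (D? x)

-- Signatures of vertices

Sig : Set
Sig = Bool → Bool → Bool

-- σ a d says whether a vertex sees a vertex with membership a and adjacency d;
-- `star d` is the signature of the centre of a neighbourhood.
full blank : Sig
full _ _ = true
blank a _ = not a

only star : Bool → Sig
only d a e = if a then not (e xor d) else true
star d a e = a xor (e xor d)

module _ (G : Graph) (P : Vertex G → Bool) where

  HasSig : Vertex G → Sig → Set
  HasSig v σ = ∀ a d → Reflects (Sees G P v a d) (σ a d)

  -- The list is both complete and attained, so sets with equal lists can be matched vertex by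
  -- vertex.
  Occ : Bool → List Sig → Set
  Occ b L = (∀ v → P v ≡ b → Any (HasSig v) L) × All (λ σ → ∃[ v ] P v ≡ b × HasSig v σ) L

  Spec : List Sig → List Sig → Set
  Spec L M = Occ true L × Occ false M

  sees? : ∀ v a d → Dec (Sees G P v a d)
  sees? v a d = any? λ u → ¬? (u ≟ v) ×-dec (P u Bool.≟ a ×-dec adj G v u Bool.≟ d)

reflects-⇒ : ∀ {A B : Set} {b} → Reflects A b → Reflects B b → A → B
reflects-⇒ (ofʸ _) (ofʸ b) _ = b
reflects-⇒ (ofⁿ ¬a) _ a = contradiction a ¬a

module _ {G H : Graph} {P : Vertex G → Bool} {Q : Vertex H → Bool} where

  occ⇒type : ∀ {b L} → Occ G P b L → Occ H Q b L →
             ∀ v → P v ≡ b → ∃[ w ] SameType G H P Q v w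
  occ⇒type (f , _) (_ , g) v eq with All.lookupAny g (f v eq)
  ... | (w , eq′ , s) , t = w , trans eq (sym eq′) ,
    (λ a d → reflects-⇒ (t a d) (s a d)) , (λ a d → reflects-⇒ (s a d) (t a d))

  spec⇒forth : ∀ {L M} → Spec G P L M → Spec H Q L M → ∀ v → ∃[ w ] SameType G H P Q v w
  spec⇒forth (i , o) (i′ , o′) v with P v in eq
  ... | true  with w , t ← occ⇒type i i′ v eq rewrite eq = w , t
  ... | false with w , t ← occ⇒type o o′ v eq rewrite eq = w , t

spec⇒match : ∀ {G H P Q L M} → Spec G P L M → Spec H Q L M → Match G H P Q
spec⇒match {G} {H} {P} {Q} s t = spec⇒forth {G} {H} {P} {Q} s t , λ w →
  let v , eq , f , g = spec⇒forth {H} {G} {Q} {P} t s w in v , sym eq , g , f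

-- Complementing both sets only renames the memberships recorded in the types.
match-not : ∀ {G H P Q} → Match G H (not ∘ P) Q → Match G H P (not ∘ Q)
match-not {G} {H} {P} {Q} (f , g) =
  (λ v → let w , t = f v in w , flip t) , (λ w → let v , t = g w in v , flip t)
  where
  flip : ∀ {v w} → SameType G H (not ∘ P) Q v w → SameType G H P (not ∘ Q) v w
  flip (p , t , s) = trans (sym (not-involutive _)) (cong not p) ,
    (λ a d (u , n , q , r) → let u′ , n′ , q′ , r′ = t (not a) d (u , n , cong not q , r)
                             in u′ , n′ , trans (cong not q′) (not-involutive a) , r′) ,
    (λ a d (u , n , q , r) → let u′ , n′ , q′ , r′ = s (not a) d (u , n , trans (sym (not-involutive _)) (cong not q) , r)
                             in u′ , n′ , not-injective q′ , r′)

match-≗ : ∀ {G H P Q Q′} → (∀ w → Q w ≡ Q′ w) → Match G H P Q → Match G H P Q′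
match-≗ {G} {H} {P} {Q} {Q′} e (f , g) =
  (λ v → let w , t = f v in w , move t) , (λ w → let v , t = g w in v , move t)
  where
  move : ∀ {v w} → SameType G H P Q v w → SameType G H P Q′ v w
  move (p , t , s) = trans p (e _) ,
    (λ a d q → let u , n , q′ , r = t a d q in u , n , trans (sym (e u)) q′ , r) ,
    (λ a d (u , n , q , r) → s a d (u , n , trans (e u) q , r))

-- Greedy cliques

module _ {G : Graph} (d : Bool) where

  insert? : ∀ x (P : Vertex G → Bool) y → Dec (y ≡ x ⊎ P y ≡ true)
  insert? x P y = y ≟ x ⊎-dec P y Bool.≟ true

  -- The list is scanned once, and a vertex is added unless it conflicts with the set built so far.
  -- The set only grows, so a conflict found on the way persists to the end.
  greedy : ∀ (L : List (Vertex G)) P → Clique G d P → ∃[ Q ] Clique G d Q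
    × (∀ x → P x ≡ true → Q x ≡ true)
    × (∀ x → Q x ≡ true → P x ≡ true ⊎ x ∈ L)
    × (∀ {x} → x ∈ L → Q x ≡ true ⊎ ∃[ y ] Q y ≡ true × y ≢ x × adj G x y ≡ not d)
  greedy [] P c = P , c , (λ _ → id) , (λ _ → inj₁) , λ ()
  greedy (x ∷ L) P c
    with any? (λ y → P y Bool.≟ true ×-dec (¬? (y ≟ x) ×-dec adj G x y Bool.≟ not d))
  ... | yes (y , p , n , r) with greedy L P c
  ...   | Q , c′ , up , down , max =
    Q , c′ , up , (λ z → Sum.map₂ there ∘ down z) ,
    λ { (here refl) → inj₂ (y , up y p , n , r) ; (there i) → max i }
  greedy (x ∷ L) P c | no none with greedy L ⟦ insert? x P ⟧ c⁺
    where
    near : ∀ y → P y ≡ true → y ≢ x → adj G x y ≡ d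
    near y p n with adj G x y Bool.≟ d
    ... | yes r = r
    ... | no ¬r = contradiction (y , p , n , ¬-not ¬r) none
    c⁺ : Clique G d ⟦ insert? x P ⟧
    c⁺ {y} {z} p q n with ⟦⟧⁻ (insert? x P) p | ⟦⟧⁻ (insert? x P) q
    ... | inj₁ refl | inj₁ refl = contradiction refl n
    ... | inj₁ refl | inj₂ q′ = near z q′ (n ∘ sym)
    ... | inj₂ p′ | inj₁ refl = trans (Graph.symm G _ _) (near y p′ n)
    ... | inj₂ p′ | inj₂ q′ = c p′ q′ n
  ... | Q , c′ , up , down , max =
    Q , c′ , (λ y p → up y (⟦⟧⁺ (insert? x P) (inj₂ p))) , down′ ,
    λ { (here refl) → inj₁ (up x (⟦⟧⁺ (insert? x P) (inj₁ refl))) ; (there i) → max i }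
    where
    down′ : ∀ y → Q y ≡ true → P y ≡ true ⊎ y ∈ (x ∷ L)
    down′ y q with down y q
    ... | inj₂ i = inj₂ (there i)
    ... | inj₁ e with ⟦⟧⁻ (insert? x P) e
    ...   | inj₁ refl = inj₂ (here refl)
    ...   | inj₂ p = inj₁ p

  -- Enlarging a dominating clique keeps it dominating.
  maximalClique : ∀ P → Clique G d P → ∃[ Q ] Clique G d Q × ¬ Out G d Q
                  × (¬ Out G (not d) P → ¬ Out G (not d) Q)
  maximalClique P c with greedy (allFin _) P c
  ... | Q , c′ , up , _ , max = Q , c′ ,
    (λ (z , z∉ , all) → case max (∈-allFin z) of λ
      { (inj₁ z∈) → clash z∈ z∉
      ; (inj₂ (y , y∈ , _ , r)) → clash (all y y∈) r }) ,
    λ ¬o (z , z∉ , all) → ¬o (z , ∉P z z∉ , λ x p → all x (up x p))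
    where
    ∉P : ∀ z → Q z ≡ false → P z ≡ false
    ∉P z q with P z in eq
    ... | false = refl
    ... | true  = clash (up z eq) q

-- Signatures that the extension property allows

outs : Bool → Bool → Bool → List Sig
outs d p q = full ∷ ((if p then only d ∷ [] else []) ++ (if q then only (not d) ∷ [] else []))

module Types (G : Graph) (E : ExtensionProperty 5 G) where

  open Extension G E
  private V = Vertex G

  abstract
    v₀ : V
    v₀ = proj₁ (extend [] z≤n λ _ → false)

    nbr : ∀ v d → ∃[ z ] z ≢ v × adj G v z ≡ d
    nbr v d with z , (r ∷ []) , [] ← witness ((v , d) ∷ []) [] ([] ∷ []) (s≤s z≤n) = z , r

    nbr₂ : ∀ {v w} → v ≢ w → ∀ d e → ∃[ z ] (z ≢ v × adj G v z ≡ d) × (z ≢ w × adj G w z ≡ e)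
    nbr₂ {v} {w} n d e
      with z , (r ∷ s ∷ []) , [] ← witness ((v , d) ∷ (w , e) ∷ []) [] ((n ∷ []) ∷ [] ∷ []) (s≤s (s≤s z≤n))
      = z , r , s

    nbr₃ : ∀ {u v w} → u ≢ v → u ≢ w → v ≢ w → ∀ c d e →
           ∃[ z ] (z ≢ u × adj G u z ≡ c) × (z ≢ v × adj G v z ≡ d) × (z ≢ w × adj G w z ≡ e)
    nbr₃ {u} {v} {w} l m n c d e
      with z , (q ∷ r ∷ s ∷ []) , [] ← witness ((u , c) ∷ (v , d) ∷ (w , e) ∷ []) []
             ((l ∷ m ∷ []) ∷ (n ∷ []) ∷ [] ∷ []) (s≤s (s≤s (s≤s z≤n)))
      = z , q , r , s

    nbr≢ : ∀ v u d → ∃[ z ] (z ≢ v × adj G v z ≡ d) × z ≢ u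
    nbr≢ v u d
      with z , (r ∷ []) , (n ∷ []) ← witness ((v , d) ∷ []) (u ∷ []) ([] ∷ []) (s≤s (s≤s z≤n)) = z , r , n

    nbr₂≢ : ∀ {v w} → v ≢ w → ∀ u d e →
            ∃[ z ] (z ≢ v × adj G v z ≡ d) × (z ≢ w × adj G w z ≡ e) × z ≢ u
    nbr₂≢ {v} {w} n u d e
      with z , (r ∷ s ∷ []) , (m ∷ []) ← witness ((v , d) ∷ (w , e) ∷ []) (u ∷ [])
             ((n ∷ []) ∷ [] ∷ []) (s≤s (s≤s (s≤s z≤n)))
      = z , r , s , m

  module _ (P : V → Bool) where

    Outer : Set
    Outer = ∀ v d → Sees G P v false d

    -- The second clause amounts to `P` having at least two vertices, since the graph is not empty.
    Regular : Set
    Regular = Outer × (∀ v → ∃[ d ] Sees G P v true d)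

  module _ {P : V → Bool} where

    hasFull : ∀ {v} → (∀ d → Sees G P v true d) → (∀ d → Sees G P v false d) → HasSig G P v full
    hasFull f g true  d = ofʸ (f d)
    hasFull f g false d = ofʸ (g d)

    hasOnly : ∀ {v} d → ¬ Sees G P v true (not d) → Sees G P v true d → (∀ e → Sees G P v false e) →
              HasSig G P v (only d)
    hasOnly d     n y g false e     = ofʸ (g e)
    hasOnly true  n y g true  true  = ofʸ y
    hasOnly true  n y g true  false = ofⁿ n
    hasOnly false n y g true  true  = ofⁿ n
    hasOnly false n y g true  false = ofʸ y

    both : ∀ {v} d → Sees G P v true d → Sees G P v true (not d) → ∀ e → Sees G P v true e
    both true  p q true  = p
    both true  p q false = q
    both false p q true  = q
    both false p q false = p

    twoInside : Regular P → ∃[ x ] ∃[ y ] y ≢ x × P x ≡ true × P y ≡ true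
    twoInside (_ , some) with some v₀
    ... | _ , x , _ , p , _ with some x
    ...   | _ , y , n , q , _ = x , y , n , p , q

    -- Fix `x` and `x′` inside and `y` outside, and for each `d` take `z` adjacent to `x`, not
    -- adjacent to `x′`, and related to `y` by `d`. If some such `z` is outside, it is full because
    -- of `x` and `x′`. If both are inside, they make `y` full.
    fullOutside : Regular P → ∃[ y ] P y ≡ false × HasSig G P y full
    fullOutside reg@(outer , _) with twoInside reg | outer v₀ true
    ... | x , x′ , n , p , p′ | y , _ , q , _ = search
      where
      y≢x : y ≢ x
      y≢x refl = clash p q
      y≢x′ : y ≢ x′
      y≢x′ refl = clash p′ q
      step : ∀ d → (∃[ y ] P y ≡ false × HasSig G P y full) ⊎ Sees G P y true d
      step d with nbr₃ (n ∘ sym) (y≢x ∘ sym) (y≢x′ ∘ sym) true false d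
      ... | z , (zx , r) , (zx′ , r′) , (zy , s) with P z in eq
      ...   | true  = inj₂ (z , zy , eq , s)
      ...   | false = inj₁ (z , eq , hasFull
                (λ { true → x , zx ∘ sym , p , trans (Graph.symm G z x) r
                   ; false → x′ , zx′ ∘ sym , p′ , trans (Graph.symm G z x′) r′ }) (outer z))
      search : ∃[ y ] P y ≡ false × HasSig G P y full
      search with step true | step false
      ... | inj₁ f | _ = f
      ... | inj₂ _ | inj₁ f = f
      ... | inj₂ s | inj₂ s′ = y , q , hasFull (λ { true → s ; false → s′ }) (outer y)

    classify : Regular P → ∀ v →
      (∀ d → Sees G P v true d) ⊎ ∃[ d ] ¬ Sees G P v true (not d) × Sees G P v true d
    classify (_ , some) v with sees? G P v true true | sees? G P v true false | some v
    ... | yes p | yes q | _ = inj₁ λ { true → p ; false → q }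
    ... | yes p | no ¬q | _ = inj₂ (true , ¬q , p)
    ... | no ¬p | yes q | _ = inj₂ (false , ¬p , q)
    ... | no ¬p | no _  | true , p = contradiction p ¬p
    ... | no _  | no ¬q | false , q = contradiction q ¬q

    only⇒out : ∀ {v} d → P v ≡ false → ¬ Sees G P v true (not d) → Out G d P
    only⇒out {v} d v∉ n = v , v∉ , λ x x∈ → near x x∈
      where
      near : ∀ x → P x ≡ true → adj G v x ≡ d
      near x x∈ with adj G v x Bool.≟ d
      ... | yes r = r
      ... | no ¬r = contradiction (x , (λ { refl → clash x∈ v∉ }) , x∈ , ¬-not ¬r) n

    out⇒only : Regular P → ∀ d → Out G d P → ∃[ v ] P v ≡ false × HasSig G P v (only d)
    out⇒only (outer , some) d (z , z∉ , all) = z , z∉ , hasOnly d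
      (λ (x , _ , x∈ , r) → clash (all x x∈) r)
      (let _ , x , n , x∈ , _ = some z in x , n , x∈ , all x x∈)
      (outer z)

    -- An outside vertex is full or sees `P` with a single adjacency `e`, and the latter means that
    -- it witnesses `Out e P`. The two flags thus determine the list.
    occOutside : Regular P → ∀ d {p q} → Reflects (Out G d P) p → Reflects (Out G (not d) P) q →
                 Occ G P false (outs d p q)
    occOutside reg@(outer , _) d rp rq = cover , fullOutside reg ∷ realise rp rq
      where
      place : ∀ {v p q} e → Reflects (Out G d P) p → Reflects (Out G (not d) P) q →
              P v ≡ false → ¬ Sees G P v true (not e) → Sees G P v true e → Any (HasSig G P v) (outs d p q)
      place {v} e rp rq v∉ n y with e Bool.≟ d
      place e (ofʸ _)  rq v∉ n y | yes refl = there (here (hasOnly e n y (outer _)))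
      place e (ofⁿ ¬o) rq v∉ n y | yes refl = contradiction (only⇒out e v∉ n) ¬o
      ... | no e≢d with ¬-not e≢d
      place .(not d) (ofʸ _) (ofʸ _) v∉ n y | no _ | refl = there (there (here (hasOnly (not d) n y (outer _))))
      place .(not d) (ofⁿ _) (ofʸ _) v∉ n y | no _ | refl = there (here (hasOnly (not d) n y (outer _)))
      place .(not d) _ (ofⁿ ¬o) v∉ n y | no _ | refl = contradiction (only⇒out (not d) v∉ n) ¬o

      cover : ∀ v → P v ≡ false → Any (HasSig G P v) _
      cover v v∉ with classify reg v
      ... | inj₁ f = here (hasFull f (outer v))
      ... | inj₂ (e , n , y) = place e rp rq v∉ n y

      realise : ∀ {p q} → Reflects (Out G d P) p → Reflects (Out G (not d) P) q →
                All (λ σ → ∃[ v ] P v ≡ false × HasSig G P v σ)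
                  ((if p then only d ∷ [] else []) ++ (if q then only (not d) ∷ [] else []))
      realise (ofʸ o) (ofʸ o′) = out⇒only reg d o ∷ out⇒only reg (not d) o′ ∷ []
      realise (ofʸ o) (ofⁿ _) = out⇒only reg d o ∷ []
      realise (ofⁿ _) (ofʸ o′) = out⇒only reg (not d) o′ ∷ []
      realise (ofⁿ _) (ofⁿ _) = []

    -- A member joined to all other members and one joined to none cannot coexist, as their own
    -- adjacency shows. Besides `full`, at most one `only d` therefore occurs inside.
    occInside : Regular P → (∃[ d ] Occ G P true (only d ∷ []))
      ⊎ (∃[ d ] Occ G P true (only d ∷ full ∷ [])) ⊎ Occ G P true (full ∷ [])
    occInside reg@(outer , some) = byCentre (centre? true) (centre? false)
      where
      Centre : Bool → Set
      Centre d = ∃[ v ] P v ≡ true × ¬ Sees G P v true (not d)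
      centre? : ∀ d → Dec (Centre d)
      centre? d = any? λ v → P v Bool.≟ true ×-dec ¬? (sees? G P v true (not d))
      Free : Set
      Free = ∃[ v ] P v ≡ true × (∀ d → Sees G P v true d)
      free? : Dec Free
      free? with any? (λ v → P v Bool.≟ true ×-dec (sees? G P v true true ×-dec sees? G P v true false))
      ... | yes (v , p , t , f) = yes (v , p , λ { true → t ; false → f })
      ... | no none = no λ (v , p , f) → none (v , p , f true , f false)
      free : Free → ∃[ v ] P v ≡ true × HasSig G P v full
      free (v , p , f) = v , p , hasFull f (outer v)

      seen : ∀ {v} d → ¬ Sees G P v true (not d) → Sees G P v true d
      seen {v} d n with classify reg v
      ... | inj₁ f = f d
      ... | inj₂ (e , _ , y) with e Bool.≟ d
      ...   | yes refl = y
      ...   | no e≢d = contradiction (subst (Sees G P v true) (¬-not e≢d) y) n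

      one : ∀ d → Centre d → ¬ Centre (not d) →
            (∃[ d ] Occ G P true (only d ∷ [])) ⊎ (∃[ d ] Occ G P true (only d ∷ full ∷ []))
      one d (c , c∈ , n) none with free?
      ... | yes fr = inj₂ (d , cover , (c , c∈ , hasOnly d n (seen d n) (outer c)) ∷ free fr ∷ [])
        where
        cover : ∀ v → P v ≡ true → Any (HasSig G P v) (only d ∷ full ∷ [])
        cover v v∈ with classify reg v
        ... | inj₁ f = there (here (hasFull f (outer v)))
        ... | inj₂ (e , m , y) with e Bool.≟ d
        ...   | yes refl = here (hasOnly e m y (outer v))
        ...   | no e≢d with refl ← ¬-not e≢d = contradiction (v , v∈ , m) none
      ... | no ¬fr = inj₁ (d , cover , (c , c∈ , hasOnly d n (seen d n) (outer c)) ∷ [])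
        where
        cover : ∀ v → P v ≡ true → Any (HasSig G P v) (only d ∷ [])
        cover v v∈ with classify reg v
        ... | inj₁ f = contradiction (v , v∈ , f) ¬fr
        ... | inj₂ (e , m , y) with e Bool.≟ d
        ...   | yes refl = here (hasOnly e m y (outer v))
        ...   | no e≢d with refl ← ¬-not e≢d = contradiction (v , v∈ , m) none

      exclusive : Centre true → ¬ Centre false
      exclusive (v , v∈ , n) (w , w∈ , m) with v ≟ w
      ... | yes refl = case some v of λ { (true , y) → m y ; (false , y) → n y }
      ... | no v≢w with adj G v w in eq
      ...   | true  = m (v , v≢w , v∈ , trans (Graph.symm G w v) eq)
      ...   | false = n (w , v≢w ∘ sym , w∈ , eq)

      byCentre : Dec (Centre true) → Dec (Centre false) → _
      byCentre (yes c) _ = Sum.map₂ inj₁ (one true c (exclusive c))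
      byCentre (no n) (yes c) = Sum.map₂ inj₁ (one false c n)
      byCentre (no n) (no m) = inj₂ (inj₂ (cover , free inhabited ∷ []))
        where
        sees : ∀ v → P v ≡ true → ∀ d → Sees G P v true d
        sees v v∈ with classify reg v
        ... | inj₁ f = f
        ... | inj₂ (true , k , _) = contradiction (v , v∈ , k) n
        ... | inj₂ (false , k , _) = contradiction (v , v∈ , k) m
        cover : ∀ v → P v ≡ true → Any (HasSig G P v) (full ∷ [])
        cover v v∈ = here (hasFull (sees v v∈) (outer v))
        inhabited : Free
        inhabited = let x , _ , _ , x∈ , _ = twoInside reg in x , x∈ , sees x x∈

-- Sets with prescribed signatures

module Build (G : Graph) (E : ExtensionProperty 5 G) where

  open Types G E
  open Extension G E using (extend)
  private
    V = Vertex G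
    symm = Graph.symm G

  -- The subscripts of these modules count the adjacencies `e` for which `Out e P` holds. Here `v`
  -- is to be the centre and `w` the uniform outside vertex: `P` consists of `v` and of the vertices
  -- related to `v` by `d` and to `w` by `e`.
  module Centred₁ (d e : Bool) where
    v w : V
    v = v₀
    w = proj₁ (nbr v e)
    w≢v : w ≢ v
    w≢v = proj₁ (proj₂ (nbr v e))
    w~v : adj G w v ≡ e
    w~v = trans (symm w v) (proj₂ (proj₂ (nbr v e)))

    D? : ∀ x → Dec (x ≡ v ⊎ (x ≢ w × adj G v x ≡ d × adj G w x ≡ e))
    D? x = x ≟ v ⊎-dec (¬? (x ≟ w) ×-dec (adj G v x Bool.≟ d ×-dec adj G w x Bool.≟ e))
    P : V → Bool
    P = ⟦ D? ⟧

    v∈ : P v ≡ true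
    v∈ = ⟦⟧⁺ D? (inj₁ refl)

    inner : ∀ x → x ≢ v → x ≢ w → ∀ c → Sees G P x true c
    inner x n m c with nbr₃ (w≢v ∘ sym) (n ∘ sym) (m ∘ sym) d e c
    ... | z , (_ , r) , (zw , s) , (zx , t) = z , zx , ⟦⟧⁺ D? (inj₂ (zw , r , s)) , t

    fromV : Sees G P v true d
    fromV with nbr₂ (w≢v ∘ sym) d e
    ... | z , (zv , r) , (zw , s) = z , zv , ⟦⟧⁺ D? (inj₂ (zw , r , s)) , r

    outer : Outer P
    outer x c with x ≟ v
    ... | yes refl with nbr₂ (w≢v ∘ sym) c (not e)
    ...   | z , (zv , r) , (_ , s) = z , zv ,
      ¬⟦⟧⁺ D? (λ { (inj₁ p) → zv p ; (inj₂ (_ , _ , p)) → clash p s }) , r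
    outer x c | no x≢v with x ≟ w
    ... | yes refl with nbr₂ (w≢v ∘ sym) (not d) c
    ...   | z , (zv , r) , (zw , s) = z , zw ,
      ¬⟦⟧⁺ D? (λ { (inj₁ p) → zv p ; (inj₂ (_ , p , _)) → clash p r }) , s
    outer x c | no x≢v | no x≢w with nbr₃ (x≢v ∘ sym) (w≢v ∘ sym) x≢w (not d) c (not e)
    ... | z , (zv , r) , (zx , s) , _ = z , zx ,
      ¬⟦⟧⁺ D? (λ { (inj₁ p) → zv p ; (inj₂ (_ , p , _)) → clash p r }) , s

    regular : Regular P
    regular = outer , some
      where
      some : ∀ x → ∃[ c ] Sees G P x true c
      some x with x ≟ v | x ≟ w
      ... | yes refl | _ = d , fromV
      ... | no x≢v | yes refl = e , v , x≢v ∘ sym , v∈ , w~v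
      ... | no x≢v | no x≢w = true , inner x x≢v x≢w true

    occIn : Occ G P true (only d ∷ full ∷ [])
    occIn = cover , (v , v∈ , onlyV) ∷ existsFull ∷ []
      where
      onlyV : HasSig G P v (only d)
      onlyV = hasOnly d (λ (u , n , p , r) → case ⟦⟧⁻ D? p of λ
        { (inj₁ u≡v) → n u≡v ; (inj₂ (_ , q , _)) → clash q r }) fromV (outer v)
      fullX : ∀ x → x ≢ v → P x ≡ true → HasSig G P x full
      fullX x n p with ⟦⟧⁻ D? p
      ... | inj₁ q = contradiction q n
      ... | inj₂ (x≢w , _) = hasFull (inner x n x≢w) (outer x)
      cover : ∀ x → P x ≡ true → Any (HasSig G P x) (only d ∷ full ∷ [])
      cover x p = [ (λ { refl → here onlyV }) , (λ n → there (here (fullX x n p))) ]′ (toSum (x ≟ v))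
      existsFull : ∃[ x ] P x ≡ true × HasSig G P x full
      existsFull with fromV
      ... | z , n , p , _ = z , p , fullX z n p

    spec : Spec G P (only d ∷ full ∷ []) (outs e true false)
    spec = occIn , occOutside regular e (ofʸ (w , w∉ , toW)) (ofⁿ none)
      where
      w∉ : P w ≡ false
      w∉ = ¬⟦⟧⁺ D? λ { (inj₁ p) → w≢v p ; (inj₂ (p , _)) → p refl }
      toW : ∀ x → P x ≡ true → adj G w x ≡ e
      toW x p with ⟦⟧⁻ D? p
      ... | inj₁ refl = w~v
      ... | inj₂ (_ , _ , r) = r
      none : ¬ Out G (not e) P
      none (z , z∉ , all) with z ≟ w
      ... | yes refl = clash w~v (all v v∈)
      ... | no z≢w with inner z (λ { refl → clash v∈ z∉ }) z≢w e
      ...   | x , _ , x∈ , r = clash r (all x x∈)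

  noOuts : ∀ {P} → (∀ z → P z ≡ false → ∀ c → Sees G P z true c) → ∀ e → ¬ Out G e P
  noOuts see e (z , z∉ , all) with see z z∉ (not e)
  ... | x , _ , x∈ , r = clash (all x x∈) r

  -- The set is `v` with its `d`-neighbours other than `u`. Leaving out `u` lets `v` see an outside
  -- vertex by `d`.
  module Centred₀ (d : Bool) where
    v u : V
    v = v₀
    u = proj₁ (nbr v d)
    u≢v : u ≢ v
    u≢v = proj₁ (proj₂ (nbr v d))
    v~u : adj G v u ≡ d
    v~u = proj₂ (proj₂ (nbr v d))

    D? : ∀ x → Dec (x ≡ v ⊎ (x ≢ u × adj G v x ≡ d))
    D? x = x ≟ v ⊎-dec (¬? (x ≟ u) ×-dec adj G v x Bool.≟ d)
    P : V → Bool
    P = ⟦ D? ⟧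

    v∈ : P v ≡ true
    v∈ = ⟦⟧⁺ D? (inj₁ refl)

    inner : ∀ x → x ≢ v → ∀ c → Sees G P x true c
    inner x n c with nbr₂≢ (n ∘ sym) u d c
    ... | z , (_ , r) , (zx , s) , zu = z , zx , ⟦⟧⁺ D? (inj₂ (zu , r)) , s

    fromV : Sees G P v true d
    fromV with nbr≢ v u d
    ... | z , (zv , r) , zu = z , zv , ⟦⟧⁺ D? (inj₂ (zu , r)) , r

    far : ∀ z → z ≢ v → adj G v z ≡ not d → P z ≡ false
    far z zv r = ¬⟦⟧⁺ D? λ { (inj₁ p) → zv p ; (inj₂ (_ , p)) → clash p r }

    outer : Outer P
    outer x c with x ≟ v
    outer x c | no x≢v with nbr₂ (x≢v ∘ sym) (not d) c
    ... | z , (zv , r) , (zx , s) = z , zx , far z zv r , s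
    outer x c | yes refl with c Bool.≟ d
    ... | yes refl = u , u≢v , ¬⟦⟧⁺ D? (λ { (inj₁ p) → u≢v p ; (inj₂ (p , _)) → p refl }) , v~u
    ... | no c≢d with nbr v (not d)
    ...   | z , zv , r = z , zv , far z zv r , trans r (sym (¬-not c≢d))

    regular : Regular P
    regular = outer , some
      where
      some : ∀ x → ∃[ c ] Sees G P x true c
      some x with x ≟ v
      ... | yes refl = d , fromV
      ... | no x≢v = true , inner x x≢v true

    spec : Spec G P (only d ∷ full ∷ []) (outs d false false)
    spec = (cover , (v , v∈ , onlyV) ∷ existsFull ∷ []) ,
      occOutside regular d (ofⁿ (noOuts seen d)) (ofⁿ (noOuts seen (not d)))
      where
      seen : ∀ z → P z ≡ false → ∀ c → Sees G P z true c
      seen z z∉ = inner z λ { refl → clash v∈ z∉ }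
      onlyV : HasSig G P v (only d)
      onlyV = hasOnly d (λ (u , n , p , r) → case ⟦⟧⁻ D? p of λ
        { (inj₁ u≡v) → n u≡v ; (inj₂ (_ , q)) → clash q r }) fromV (outer v)
      fullX : ∀ x → x ≢ v → HasSig G P x full
      fullX x n = hasFull (inner x n) (outer x)
      cover : ∀ x → P x ≡ true → Any (HasSig G P x) (only d ∷ full ∷ [])
      cover x p = [ (λ { refl → here onlyV }) , (λ n → there (here (fullX x n))) ]′ (toSum (x ≟ v))
      existsFull : ∃[ x ] P x ≡ true × HasSig G P x full
      existsFull with fromV
      ... | z , n , p , _ = z , p , fullX z n

  -- The set is `v` with its neighbours, adjusted for the sake of `v` alone: the non-neighbour `w`
  -- is put in and the neighbour `u` is left out.
  module Full₀ where
    v u w : V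
    v = v₀
    u = proj₁ (nbr v true)
    w = proj₁ (nbr v false)
    v~u : adj G v u ≡ true
    v~u = proj₂ (proj₂ (nbr v true))
    v≁w : adj G v w ≡ false
    v≁w = proj₂ (proj₂ (nbr v false))
    u≢v : u ≢ v
    u≢v = proj₁ (proj₂ (nbr v true))
    w≢v : w ≢ v
    w≢v = proj₁ (proj₂ (nbr v false))
    u≢w : u ≢ w
    u≢w eq = true≢false (trans (sym v~u) (trans (cong (adj G v) eq) v≁w))

    D? : ∀ x → Dec (x ≡ v ⊎ x ≡ w ⊎ (x ≢ u × adj G v x ≡ true))
    D? x = x ≟ v ⊎-dec (x ≟ w ⊎-dec (¬? (x ≟ u) ×-dec adj G v x Bool.≟ true))
    P : V → Bool
    P = ⟦ D? ⟧

    inner : ∀ x c → Sees G P x true c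
    inner x c with x ≟ v
    inner x c | no n with nbr₂≢ (n ∘ sym) u true c
    ... | z , (_ , r) , (zx , s) , zu = z , zx , ⟦⟧⁺ D? (inj₂ (inj₂ (zu , r))) , s
    inner x false | yes refl = w , w≢v , ⟦⟧⁺ D? (inj₂ (inj₁ refl)) , v≁w
    inner x true  | yes refl with nbr≢ v u true
    ... | z , (zv , r) , zu = z , zv , ⟦⟧⁺ D? (inj₂ (inj₂ (zu , r))) , r

    far : ∀ z → z ≢ v → z ≢ w → adj G v z ≡ false → P z ≡ false
    far z zv zw r = ¬⟦⟧⁺ D? λ
      { (inj₁ p) → zv p ; (inj₂ (inj₁ p)) → zw p ; (inj₂ (inj₂ (_ , p))) → clash p r }

    outer : Outer P
    outer x c with x ≟ v
    outer x c | no n with nbr₂≢ (n ∘ sym) w false c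
    ... | z , (zv , r) , (zx , s) , zw = z , zx , far z zv zw r , s
    outer x true  | yes refl = u , u≢v , ¬⟦⟧⁺ D?
      (λ { (inj₁ p) → u≢v p ; (inj₂ (inj₁ p)) → u≢w p ; (inj₂ (inj₂ (p , _))) → p refl }) , v~u
    outer x false | yes refl with nbr≢ v w false
    ... | z , (zv , r) , zw = z , zv , far z zv zw r , r

    spec : Spec G P (full ∷ []) (outs true false false)
    spec = ((λ x _ → here (hasFull (inner x) (outer x))) ,
            (v , ⟦⟧⁺ D? (inj₁ refl) , hasFull (inner v) (outer v)) ∷ []) ,
      occOutside (outer , λ x → true , inner x true) true
        (ofⁿ (noOuts (λ z _ → inner z) true)) (ofⁿ (noOuts (λ z _ → inner z) false))

  -- The set is the `e`-neighbourhood of `w`, without `u` so that `w` sees an outside vertex by `e`.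
  -- The clause `x ≢ w` matters when `e` is `false`, since `w` is not adjacent to itself.
  module Full₁ (e : Bool) where
    w u : V
    w = v₀
    u = proj₁ (nbr w e)
    u≢w : u ≢ w
    u≢w = proj₁ (proj₂ (nbr w e))
    w~u : adj G w u ≡ e
    w~u = proj₂ (proj₂ (nbr w e))

    D? : ∀ x → Dec (x ≢ w × x ≢ u × adj G w x ≡ e)
    D? x = ¬? (x ≟ w) ×-dec (¬? (x ≟ u) ×-dec adj G w x Bool.≟ e)
    P : V → Bool
    P = ⟦ D? ⟧

    inner : ∀ x → x ≢ w → ∀ c → Sees G P x true c
    inner x n c with nbr₂≢ (n ∘ sym) u e c
    ... | z , (zw , r) , (zx , s) , zu = z , zx , ⟦⟧⁺ D? (zw , zu , r) , s

    fromW : Sees G P w true e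
    fromW with nbr≢ w u e
    ... | z , (zw , r) , zu = z , zw , ⟦⟧⁺ D? (zw , zu , r) , r

    outer : Outer P
    outer x c with x ≟ w
    outer x c | no x≢w with nbr₂ (x≢w ∘ sym) (not e) c
    ... | z , (_ , r) , (zx , s) = z , zx , ¬⟦⟧⁺ D? (λ (_ , _ , p) → clash p r) , s
    outer x c | yes refl with c Bool.≟ e
    ... | yes refl = u , u≢w , ¬⟦⟧⁺ D? (λ (_ , p , _) → p refl) , w~u
    ... | no c≢e with nbr w (not e)
    ...   | z , zw , r = z , zw , ¬⟦⟧⁺ D? (λ (_ , _ , p) → clash p r) , trans r (sym (¬-not c≢e))

    regular : Regular P
    regular = outer , some
      where
      some : ∀ x → ∃[ c ] Sees G P x true c
      some x with x ≟ w
      ... | yes refl = e , fromW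
      ... | no n = true , inner x n true

    spec : Spec G P (full ∷ []) (outs e true false)
    spec = ((λ x p → here (fullX x p)) , (let z , _ , p , _ = fromW in z , p , fullX z p) ∷ []) ,
      occOutside regular e (ofʸ (w , w∉ , λ x p → proj₂ (proj₂ (⟦⟧⁻ D? p)))) (ofⁿ none)
      where
      w∉ : P w ≡ false
      w∉ = ¬⟦⟧⁺ D? λ (p , _) → p refl
      fullX : ∀ x → P x ≡ true → HasSig G P x full
      fullX x p = hasFull (inner x (proj₁ (⟦⟧⁻ D? p))) (outer x)
      none : ¬ Out G (not e) P
      none (z , z∉ , all) with z ≟ w
      ... | yes refl with fromW
      ...   | x , _ , x∈ , r = clash r (all x x∈)
      none (z , z∉ , all) | no n with inner z n e
      ... | x , _ , x∈ , r = clash r (all x x∈)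

  -- A set this small always has uniform outside vertices of both kinds, by the extension property
  -- applied to the set itself.
  module Small (S : List V) (len : length S ≤ 4) where
    open DecMem (_≟_ {order G}) using () renaming (_∈?_ to _∈ᴸ?_)

    P : V → Bool
    P = ⟦ _∈ᴸ? S ⟧

    ∈⇒P : ∀ {x} → x ∈ S → P x ≡ true
    ∈⇒P {x} = ⟦⟧⁺ (_∈ᴸ? S)

    P⇒∈ : ∀ {x} → P x ≡ true → x ∈ S
    P⇒∈ {x} = ⟦⟧⁻ (_∈ᴸ? S)

    outer : Outer P
    -- Four members of `S` and `x` make five constraints, the most that is ever asked for. This is
    -- the source of the constant 5.
    outer x c with extend (x ∷ S) (s≤s len) (λ _ → c)
    ... | z , h = z , proj₁ (h (here refl)) ,
      ¬⟦⟧⁺ (_∈ᴸ? S) (λ z∈ → proj₁ (h (there z∈)) refl) , proj₂ (h (here refl))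

    out : ∀ e → Out G e P
    out e with extend S (≤-trans len (s≤s (s≤s (s≤s (s≤s z≤n))))) (λ _ → e)
    ... | z , h = z , ¬⟦⟧⁺ (_∈ᴸ? S) (λ z∈ → proj₁ (h z∈) refl) ,
      λ x p → trans (symm z x) (proj₂ (h (P⇒∈ p)))

    regular : ∀ {x y} → x ≢ y → x ∈ S → y ∈ S → Regular P
    regular {x} {y} x≢y x∈ y∈ = outer , some
      where
      some : ∀ v → ∃[ d ] Sees G P v true d
      some v with x ≟ v
      ... | yes refl = _ , y , x≢y ∘ sym , ∈⇒P y∈ , refl
      ... | no n = _ , x , n , ∈⇒P x∈ , refl

  -- A pair is too small to be a maximal or a dominating clique.
  module Clique₂ (d : Bool) where
    p q : V
    p = v₀
    q = proj₁ (nbr p d)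
    q≢p : q ≢ p
    q≢p = proj₁ (proj₂ (nbr p d))
    pq : adj G p q ≡ d
    pq = proj₂ (proj₂ (nbr p d))
    qp : adj G q p ≡ d
    qp = trans (symm q p) pq

    open Small (p ∷ q ∷ []) (s≤s (s≤s z≤n)) public

    spec : Spec G P (only d ∷ []) (outs d true true)
    spec = ((λ x x∈ → here (sig x (P⇒∈ x∈))) , (p , ∈⇒P (here refl) , sig p (here refl)) ∷ []) ,
      occOutside (regular (q≢p ∘ sym) (here refl) (there (here refl))) d (ofʸ (out d)) (ofʸ (out (not d)))
      where
      sig : ∀ x → x ∈ p ∷ q ∷ [] → HasSig G P x (only d)
      sig _ (here refl) = hasOnly d
        (λ (u , n , u∈ , r) → case P⇒∈ u∈ of λ { (here e) → n e ; (there (here refl)) → clash pq r })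
        (q , q≢p , ∈⇒P (there (here refl)) , pq) (outer p)
      sig _ (there (here refl)) = hasOnly d
        (λ (u , n , u∈ , r) → case P⇒∈ u∈ of λ { (here refl) → clash qp r ; (there (here e)) → n e })
        (p , q≢p ∘ sym , ∈⇒P (here refl) , qp) (outer q)

  -- The set is an induced path on three vertices with middle vertex `p`, or the complement of one
  -- when `d` is `false`.
  module Centred₂ (d : Bool) where
    p q r : V
    p = v₀
    q = proj₁ (nbr p d)
    q≢p : q ≢ p
    q≢p = proj₁ (proj₂ (nbr p d))
    pq : adj G p q ≡ d
    pq = proj₂ (proj₂ (nbr p d))
    private R = nbr₂ (q≢p ∘ sym) d (not d)
    r = proj₁ R
    r≢p : r ≢ p
    r≢p = proj₁ (proj₁ (proj₂ R))
    pr : adj G p r ≡ d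
    pr = proj₂ (proj₁ (proj₂ R))
    r≢q : r ≢ q
    r≢q = proj₁ (proj₂ (proj₂ R))
    qr : adj G q r ≡ not d
    qr = proj₂ (proj₂ (proj₂ R))

    open Small (p ∷ q ∷ r ∷ []) (s≤s (s≤s (s≤s z≤n))) public

    spec : Spec G P (only d ∷ full ∷ []) (outs d true true)
    spec = ((λ x x∈ → sig x (P⇒∈ x∈)) ,
            (p , ∈⇒P (here refl) , sigP) ∷ (q , ∈⇒P (there (here refl)) , sigQ) ∷ []) ,
      occOutside (regular (q≢p ∘ sym) (here refl) (there (here refl))) d (ofʸ (out d)) (ofʸ (out (not d)))
      where
      sigP : HasSig G P p (only d)
      sigP = hasOnly d
        (λ (u , n , u∈ , s) → case P⇒∈ u∈ of λ
          { (here e) → n e ; (there (here refl)) → clash pq s ; (there (there (here refl))) → clash pr s })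
        (q , q≢p , ∈⇒P (there (here refl)) , pq) (outer p)
      sigQ : HasSig G P q full
      sigQ = hasFull (both d (p , q≢p ∘ sym , ∈⇒P (here refl) , trans (symm q p) pq)
        (r , r≢q , ∈⇒P (there (there (here refl))) , qr)) (outer q)
      sig : ∀ x → x ∈ p ∷ q ∷ r ∷ [] → Any (HasSig G P x) (only d ∷ full ∷ [])
      sig _ (here refl) = here sigP
      sig _ (there (here refl)) = there (here sigQ)
      sig _ (there (there (here refl))) = there (here (hasFull
        (both d (p , r≢p ∘ sym , ∈⇒P (here refl) , trans (symm r p) pr)
          (q , r≢q ∘ sym , ∈⇒P (there (here refl)) , trans (symm r q) qr)) (outer r)))

  -- The set is an induced path on four vertices.
  full₂ : ∃[ P ] Spec G P (full ∷ []) (outs true true true)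
  full₂ with nbr v₀ true
  ... | q , q≢p , pq with nbr₂ (q≢p ∘ sym) false true
  ... | r , (r≢p , pr) , (r≢q , qr) with nbr₃ (q≢p ∘ sym) (r≢p ∘ sym) (r≢q ∘ sym) false false true
  ... | t , (t≢p , pt) , (t≢q , qt) , (t≢r , rt) = P ,
    ((λ x x∈ → here (sig x (P⇒∈ x∈))) , (p , ∈⇒P p∈ , sig p p∈) ∷ []) ,
    occOutside (regular (q≢p ∘ sym) p∈ q∈) true (ofʸ (out true)) (ofʸ (out false))
    where
    p = v₀
    open Small (p ∷ q ∷ r ∷ t ∷ []) (s≤s (s≤s (s≤s (s≤s z≤n))))
    p∈ : p ∈ p ∷ q ∷ r ∷ t ∷ []
    p∈ = here refl
    q∈ : q ∈ p ∷ q ∷ r ∷ t ∷ []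
    q∈ = there (here refl)
    r∈ : r ∈ p ∷ q ∷ r ∷ t ∷ []
    r∈ = there (there (here refl))
    t∈ : t ∈ p ∷ q ∷ r ∷ t ∷ []
    t∈ = there (there (there (here refl)))
    sig : ∀ x → x ∈ p ∷ q ∷ r ∷ t ∷ [] → HasSig G P x full
    sig x x∈ = hasFull (seen x x∈) (outer x)
      where
      seen : ∀ x → x ∈ p ∷ q ∷ r ∷ t ∷ [] → ∀ d → Sees G P x true d
      seen _ (here refl) true  = q , q≢p , ∈⇒P q∈ , pq
      seen _ (here refl) false = r , r≢p , ∈⇒P r∈ , pr
      seen _ (there (here refl)) true  = p , q≢p ∘ sym , ∈⇒P p∈ , trans (symm q p) pq
      seen _ (there (here refl)) false = t , t≢q , ∈⇒P t∈ , qt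
      seen _ (there (there (here refl))) true  = q , r≢q ∘ sym , ∈⇒P q∈ , trans (symm r q) qr
      seen _ (there (there (here refl))) false = p , r≢p ∘ sym , ∈⇒P p∈ , trans (symm r p) pr
      seen _ (there (there (there (here refl)))) true  = r , t≢r ∘ sym , ∈⇒P r∈ , trans (symm t r) rt
      seen _ (there (there (there (here refl)))) false = p , t≢p ∘ sym , ∈⇒P p∈ , trans (symm t p) pt

  centred : ∀ d p q → ∃[ P ] Spec G P (only d ∷ full ∷ []) (outs d p q)
  centred d true  true  = _ , Centred₂.spec d
  centred d true  false = _ , Centred₁.spec d d
  -- `outs (not d) true false` and `outs d false true` compute to the same list.
  centred d false true  = _ , Centred₁.spec d (not d)
  centred d false false = _ , Centred₀.spec d

  allFull : ∀ p q → ∃[ P ] Spec G P (full ∷ []) (outs true p q)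
  allFull true  true  = full₂
  allFull true  false = _ , Full₁.spec true
  allFull false true  = _ , Full₁.spec false
  allFull false false = _ , Full₀.spec

  emptySpec : ∀ {P} → (∀ v → P v ≡ false) → Spec G P [] (blank ∷ [])
  emptySpec {P} e = ((λ v p → clash p (e v)) , []) , (λ v _ → here (sig v)) , (v₀ , e v₀ , sig v₀) ∷ []
    where
    sig : ∀ v → HasSig G P v blank
    sig v true  d = ofⁿ λ (u , _ , p , _) → clash p (e u)
    sig v false d = ofʸ (let z , n , r = nbr v d in z , n , e z , r)

  singleSpec : ∀ {P v} → P v ≡ true → (∀ u → u ≢ v → P u ≡ false) →
               Spec G P (blank ∷ []) (only true ∷ only false ∷ [])
  singleSpec {P} {v} v∈ e =
    ((λ u p → here (subst (λ u → HasSig G P u blank) (sym (isV u p)) sigV)) , (v , v∈ , sigV) ∷ []) ,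
    cover , exists true ∷ exists false ∷ []
    where
    isV : ∀ u → P u ≡ true → u ≡ v
    isV u p with u ≟ v
    ... | yes u≡v = u≡v
    ... | no n = clash p (e u n)
    sigV : HasSig G P v blank
    sigV true  d = ofⁿ λ (u , n , p , _) → n (isV u p)
    sigV false d = ofʸ (let z , n , r = nbr v d in z , n , e z n , r)
    sig : ∀ d u → u ≢ v → adj G u v ≡ d → HasSig G P u (only d)
    sig d u n r = hasOnly d
      (λ (x , _ , p , s) → clash r (trans (cong (adj G u) (sym (isV x p))) s))
      (v , n ∘ sym , v∈ , r)
      (λ c → let z , (zv , _) , (zu , s) = nbr₂ (n ∘ sym) c c in z , zu , e z zv , s)
    exists : ∀ d → ∃[ u ] P u ≡ false × HasSig G P u (only d)
    exists d = let z , n , r = nbr v d in z , e z n , sig d z n (trans (symm z v) r)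
    cover : ∀ u → P u ≡ false → Any (HasSig G P u) (only true ∷ only false ∷ [])
    cover u u∉ with adj G u v in eq
    ... | true  = here (sig true u (λ { refl → clash v∈ u∉ }) eq)
    ... | false = there (here (sig false u (λ { refl → clash v∈ u∉ }) eq))

  -- The adjacency of a vertex to `v` decides its membership. For `u` other than `v`, `nbr₂`
  -- prescribes adjacency to `v` and to `u` at once, so `u` is full.
  starSpec : ∀ {P v} d → P v ≡ false → (∀ u → u ≢ v → P u ≡ true → adj G v u ≡ d) →
             (∀ u → u ≢ v → P u ≡ false → adj G v u ≡ not d) →
             Spec G P (full ∷ []) (star d ∷ full ∷ [])
  starSpec {P} {v} d v∉ inn out =
    ((λ u p → here (sig u (λ { refl → clash p v∉ }))) , existsIn ∷ []) ,
    cover , (v , v∉ , sigV) ∷ existsOut ∷ []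
    where
    isIn : ∀ u → u ≢ v → adj G v u ≡ d → P u ≡ true
    isIn u n r with P u in eq
    ... | true = refl
    ... | false = clash r (out u n eq)
    isOut : ∀ u → u ≢ v → adj G v u ≡ not d → P u ≡ false
    isOut u n r with P u in eq
    ... | false = refl
    ... | true = clash (inn u n eq) r
    sig : ∀ u → u ≢ v → HasSig G P u full
    sig u n = hasFull
      (λ c → let z , (zv , r) , (zu , s) = nbr₂ (n ∘ sym) d c in z , zu , isIn z zv r , s)
      (λ c → let z , (zv , r) , (zu , s) = nbr₂ (n ∘ sym) (not d) c in z , zu , isOut z zv r , s)
    sigV : HasSig G P v (star d)
    sigV = go d inn out isIn isOut
      where
      go : ∀ d → (∀ u → u ≢ v → P u ≡ true → adj G v u ≡ d) →
           (∀ u → u ≢ v → P u ≡ false → adj G v u ≡ not d) →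
           (∀ u → u ≢ v → adj G v u ≡ d → P u ≡ true) →
           (∀ u → u ≢ v → adj G v u ≡ not d → P u ≡ false) → HasSig G P v (star d)
      go true  i o i′ o′ true  true  = ofʸ (let z , n , r = nbr v true in z , n , i′ z n r , r)
      go true  i o i′ o′ true  false = ofⁿ λ (u , n , p , r) → clash r (i u n p)
      go true  i o i′ o′ false true  = ofⁿ λ (u , n , p , r) → clash r (o u n p)
      go true  i o i′ o′ false false = ofʸ (let z , n , r = nbr v false in z , n , o′ z n r , r)
      go false i o i′ o′ true  true  = ofⁿ λ (u , n , p , r) → clash r (i u n p)
      go false i o i′ o′ true  false = ofʸ (let z , n , r = nbr v false in z , n , i′ z n r , r)
      go false i o i′ o′ false true  = ofʸ (let z , n , r = nbr v true in z , n , o′ z n r , r)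
      go false i o i′ o′ false false = ofⁿ λ (u , n , p , r) → clash r (o u n p)
    existsIn : ∃[ u ] P u ≡ true × HasSig G P u full
    existsIn = let z , n , r = nbr v d in z , isIn z n r , sig z n
    existsOut : ∃[ u ] P u ≡ false × HasSig G P u full
    existsOut = let z , n , r = nbr v (not d) in z , isOut z n r , sig z n
    cover : ∀ u → P u ≡ false → Any (HasSig G P u) (star d ∷ full ∷ [])
    cover u p with u ≟ v
    ... | yes refl = here sigV
    ... | no n = there (here (sig u n))

  starSet : ∀ d → ∃[ P ] Spec G P (full ∷ []) (star d ∷ full ∷ [])
  starSet d = ⟦ D? ⟧ , starSpec d (¬⟦⟧⁺ D? λ (p , _) → p refl)
    (λ u n p → proj₂ (⟦⟧⁻ D? p))
    (λ u n p → ¬-not λ r → ¬⟦⟧⁻ D? p (n , r))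
    where
    D? : ∀ x → Dec (x ≢ v₀ × adj G v₀ x ≡ d)
    D? x = ¬? (x ≟ v₀) ×-dec adj G v₀ x Bool.≟ d

  singleSet : ∃[ P ] Spec G P (blank ∷ []) (only true ∷ only false ∷ [])
  singleSet = ⟦ _≟ v₀ ⟧ , singleSpec {v = v₀} (⟦⟧⁺ (_≟ v₀) refl) (λ u n → ¬⟦⟧⁺ (_≟ v₀) n)

  -- A clique with at most one vertex has outside vertices of both kinds.
  cliqueSpec : ∀ d {P p q} → Clique G d P → Reflects (Out G d P) p → Reflects (Out G (not d) P) q →
               ¬ (Out G d P × Out G (not d) P) → Spec G P (only d ∷ []) (outs d p q)
  cliqueSpec d {P} c rp rq ¬both = occIn , occOutside (outer , some) d rp rq
    where
    outer : Outer P
    outer v e with nbr v e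
    ... | z , zv , r with P z in pz
    ...   | false = z , zv , pz , r
    -- If `z` is in the clique, then `z′`, related to `z` by `not d`, cannot be.
    ...   | true with nbr₂ (zv ∘ sym) e (not d)
    ...     | z′ , (z′v , r′) , (z′z , s) with P z′ in pz′
    ...       | false = z′ , z′v , pz′ , r′
    ...       | true = clash (c pz pz′ (z′z ∘ sym)) s
    outSmall : ∀ v → (∀ u → u ≢ v → P u ≡ false) → ∀ e → Out G e P
    outSmall v f e with nbr v e
    ... | z , zv , r = z , f z zv , λ x x∈ → trans (symm z x)
      (trans (cong (λ x → adj G x z) (isV x x∈)) r)
      where
      isV : ∀ x → P x ≡ true → x ≡ v
      isV x x∈ with x ≟ v
      ... | yes x≡v = x≡v
      ... | no n = clash x∈ (f x n)
    some : ∀ v → ∃[ e ] Sees G P v true e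
    some v with sees? G P v true true | sees? G P v true false
    ... | yes s | _ = true , s
    ... | no _ | yes s = false , s
    ... | no s | no s′ = contradiction (outSmall v f d , outSmall v f (not d)) ¬both
      where
      f : ∀ u → u ≢ v → P u ≡ false
      f u n with P u in p | adj G v u in r
      ... | false | _ = refl
      ... | true | true = contradiction (u , n , p , r) s
      ... | true | false = contradiction (u , n , p , r) s′
    sig : ∀ v → P v ≡ true → HasSig G P v (only d)
    sig v v∈ = hasOnly d (λ (u , n , u∈ , r) → clash (c v∈ u∈ (n ∘ sym)) r)
      (let _ , u , n , u∈ , _ = some v in u , n , u∈ , c v∈ u∈ (n ∘ sym)) (outer v)
    occIn : Occ G P true (only d ∷ [])
    occIn = (λ v v∈ → here (sig v v∈)) ,
      (let _ , u , _ , u∈ , _ = some v₀ in u , u∈ , sig u u∈) ∷ []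

-- Answering a set in one graph by a set in the other

module Transfer (G H : Graph) (EG : ExtensionProperty 5 G) (EH : ExtensionProperty 5 H)
  (same¹ : ∀ d → ¬ (G ⊨ φ¹ d) → ¬ (H ⊨ φ¹ d))
  (same² : ∀ d → ¬ (G ⊨ φ² d) → ¬ (H ⊨ φ² d))
  (same³ : ∀ d → ¬ (G ⊨ φ³ d) → ¬ (H ⊨ φ³ d)) where

  open Types G EG using (Outer; Regular; occInside; occOutside)
  module BG = Build G EG
  module BH = Build H EH
  module TG = Types G EG

  only⇒clique : ∀ {P d} → Occ G P true (only d ∷ []) → Clique G d P
  only⇒clique {P} {d} (f , _) {x} {y} p q n with f x p
  ... | here s with adj G x y Bool.≟ d
  ...   | yes r = r
  ...   | no ¬r = ⊥-elim (unseen d s (y , n ∘ sym , q , ¬-not ¬r))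
    where
    unseen : ∀ d → HasSig G P x (only d) → ¬ Sees G P x true (not d)
    unseen true  s y with s true false
    ... | ofⁿ ¬y = ¬y y
    unseen false s y with s true true
    ... | ofⁿ ¬y = ¬y y

  -- A clique neither maximal nor dominating is answered by a pair. In the mixed cases the clique
  -- refutes `φ³` or `φ²`, and the refutation in `H` supplies the answer. A maximal dominating
  -- clique refutes `φ¹`, which gives a dominating clique in `H`, and this is enlarged to a maximal
  -- one.
  cliqueReply : ∀ d (X : Subset (order G)) {p q} → Clique G d (lookup X) →
    Reflects (Out G d (lookup X)) p → Reflects (Out G (not d) (lookup X)) q →
    ∃[ Q ] Spec H Q (only d ∷ []) (outs d p q)
  cliqueReply d X c (ofʸ _) (ofʸ _) = _ , BH.Clique₂.spec d
  cliqueReply d X c (ofʸ o) (ofⁿ ¬o) with ⊭φ³⇒ H d (same³ d (⊭φ³ G d X c ¬o o))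
  ... | Y , c′ , ¬o′ , o′ = lookup Y , BH.cliqueSpec d c′ (ofʸ o′) (ofⁿ ¬o′) (¬o′ ∘ proj₂)
  cliqueReply d X c (ofⁿ ¬o) (ofʸ o) with ⊭φ²⇒ H d (same² d (⊭φ² G d X c ¬o o))
  ... | Y , c′ , ¬o′ , o′ = lookup Y , BH.cliqueSpec d c′ (ofⁿ ¬o′) (ofʸ o′) (¬o′ ∘ proj₁)
  cliqueReply d X c (ofⁿ _) (ofⁿ ¬o) with ⊭φ¹⇒ H d (same¹ d (⊭φ¹ G d X c ¬o))
  ... | Y , c′ , ¬o′ with maximalClique {H} d (lookup Y) c′
  ...   | Q , cQ , ¬oQ , dom = Q , BH.cliqueSpec d cQ (ofⁿ ¬oQ) (ofⁿ (dom ¬o′)) (¬oQ ∘ proj₁)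

  regularReply : ∀ X → Regular (lookup X) → ∃[ Q ] Match G H (lookup X) Q
  regularReply X reg with occInside {lookup X} reg
  ... | inj₁ (d , i) =
    let Q , s = cliqueReply d X (only⇒clique i) (proof (out? {G} {X} d)) (proof (out? {G} {X} (not d)))
    in Q , spec⇒match {G} {H} (i , occOutside reg d (proof (out? {G} {X} d)) (proof (out? {G} {X} (not d)))) s
  ... | inj₂ (inj₁ (d , i)) =
    let Q , s = BH.centred d (does (out? {G} {X} d)) (does (out? {G} {X} (not d)))
    in Q , spec⇒match {G} {H} (i , occOutside reg d (proof (out? {G} {X} d)) (proof (out? {G} {X} (not d)))) s
  ... | inj₂ (inj₂ i) =
    let Q , s = BH.allFull (does (out? {G} {X} true)) (does (out? {G} {X} false))
    in Q , spec⇒match {G} {H} (i , occOutside reg true (proof (out? {G} {X} true)) (proof (out? {G} {X} false))) s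

  -- If some `v` sees no member of `X`, then `X` is empty or consists of `v`. Otherwise `X` is
  -- regular.
  outerReply : ∀ X → Outer (lookup X) → ∃[ Q ] Match G H (lookup X) Q
  outerReply X outer
    with any? (λ v → ¬? (sees? G (lookup X) v true true) ×-dec ¬? (sees? G (lookup X) v true false))
  ... | no none = regularReply X (outer , some)
    where
    some : ∀ v → ∃[ d ] Sees G (lookup X) v true d
    some v with sees? G (lookup X) v true true | sees? G (lookup X) v true false
    ... | yes s | _ = true , s
    ... | no _ | yes s = false , s
    ... | no s | no s′ = contradiction (v , s , s′) none
  ... | yes (v , s , s′) = byMember (lookup X v) refl
    where
    others : ∀ u → u ≢ v → lookup X u ≡ false
    others u n with lookup X u in p | adj G v u in r
    ... | false | _ = refl
    ... | true | true = contradiction (u , n , p , r) s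
    ... | true | false = contradiction (u , n , p , r) s′
    byMember : ∀ b → lookup X v ≡ b → ∃[ Q ] Match G H (lookup X) Q
    byMember true  p = let Q , t = BH.singleSet in Q , spec⇒match {G} {H} (BG.singleSpec p others) t
    byMember false p = _ , spec⇒match {G} {H} (BG.emptySpec all) (BH.emptySpec {λ _ → false} (λ _ → refl))
      where
      all : ∀ u → lookup X u ≡ false
      all u with u ≟ v
      ... | yes refl = p
      ... | no n = others u n

  Missing : Subset (order G) → Bool → Set
  Missing X a = ∃[ v ] ∃[ d ] ¬ Sees G (lookup X) v a d

  missing? : ∀ X a → Dec (Missing X a)
  missing? X a with any? (λ v → ¬? (sees? G (lookup X) v a true) ⊎-dec ¬? (sees? G (lookup X) v a false))
  ... | yes (v , inj₁ n) = yes (v , true , n)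
  ... | yes (v , inj₂ n) = yes (v , false , n)
  ... | no none = no λ { (v , true , n) → none (v , inj₁ n) ; (v , false , n) → none (v , inj₂ n) }

  ¬missing⇒sees : ∀ X a → ¬ Missing X a → ∀ v d → Sees G (lookup X) v a d
  ¬missing⇒sees X a none v d with sees? G (lookup X) v a d
  ... | yes s = s
  ... | no n = contradiction (v , d , n) none

  complement : ∀ X → ∃[ Z ] (∀ v → lookup {n = order G} Z v ≡ not (lookup X v))
  complement X = tabulate (not ∘ lookup X) , lookup∘tabulate (not ∘ lookup X)

  viaComplement : ∀ X → (∀ Z → (∀ v → lookup Z v ≡ not (lookup X v)) → ∃[ Q ] Match G H (lookup Z) Q) →
                  ∃[ Q ] Match G H (lookup X) Q
  viaComplement X f with complement X
  ... | Z , eq with f Z eq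
  ...   | Q , (g , h) = not ∘ Q , match-not {G} {H} {lookup X} {Q}
    ((λ v → let w , t = g v in w , move t) , (λ w → let v , t = h w in v , move t))
    where
    move : ∀ {v w} → SameType G H (lookup Z) Q v w → SameType G H (not ∘ lookup X) Q v w
    move (p , t , s) = trans (sym (eq _)) p ,
      (λ a d (u , n , q , r) → t a d (u , n , trans (eq u) q , r)) ,
      (λ a d q → let u , n , q′ , r = s a d q in u , n , trans (sym (eq u)) q′ , r)

  starReply : ∀ X v d → lookup X v ≡ false → ¬ Sees G (lookup X) v true (not d) →
              ¬ Sees G (lookup X) v false d → ∃[ Q ] Match G H (lookup X) Q
  starReply X v d v∉ n m = let Q , t = BH.starSet d in Q , spec⇒match {G} {H} (BG.starSpec d v∉ inn out) t
    where
    inn : ∀ u → u ≢ v → lookup X u ≡ true → adj G v u ≡ d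
    inn u u≢v p with adj G v u Bool.≟ d
    ... | yes r = r
    ... | no ¬r = contradiction (u , u≢v , p , ¬-not ¬r) n
    out : ∀ u → u ≢ v → lookup X u ≡ false → adj G v u ≡ not d
    out u u≢v p = ¬-not λ r → m (u , u≢v , p , r)

  -- If every vertex sees everything outside `X`, or everything inside, the outer case applies to
  -- `X` or its complement. Otherwise `v` lacks some `d` inside and `w` lacks some `e` outside. A
  -- common witness for `d` and `e` would have to lie on one side, so `v` equals `w`, and likewise
  -- `e` differs from `d`. Up to complement, `X` is then a neighbourhood of `v`.
  reply : ∀ X → ∃[ Q ] Match G H (lookup X) Q
  reply X with missing? X true | missing? X false
  ... | _ | no none = outerReply X (¬missing⇒sees X false none)
  ... | no none | yes _ = viaComplement X λ Z eq → outerReply Z λ v d →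
    let u , n , p , r = ¬missing⇒sees X true none v d in u , n , trans (eq u) (cong not p) , r
  ... | yes (v , d , n) | yes (w , e , m) with v ≟ w
  ...   | no v≢w with TG.nbr₂ v≢w d e
  ...     | z , (zv , r) , (zw , s) with lookup X z in p
  ...       | true = contradiction (z , zv , p , r) n
  ...       | false = contradiction (z , zw , p , s) m
  reply X | yes (v , d , n) | yes (w , e , m) | yes refl with e Bool.≟ d
  ...   | yes refl with TG.nbr v d
  ...     | z , zv , r with lookup X z in p
  ...       | true = contradiction (z , zv , p , r) n
  ...       | false = contradiction (z , zv , p , r) m
  reply X | yes (v , d , n) | yes (w , e , m) | yes refl | no e≢d with ¬-not e≢d
  ...   | refl with lookup X v in p
  ...     | false = starReply X v (not d) p (n ∘ subst (Sees G (lookup X) v true) (not-involutive d)) m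
  ...     | true = viaComplement X λ Z eq → starReply Z v d (trans (eq v) (cong not p))
    (λ (u , u≢ , q , r) → m (u , u≢ , trans (sym (not-involutive _)) (cong not (trans (sym (eq u)) q)) , r))
    (λ (u , u≢ , q , r) → n (u , u≢ , trans (sym (not-involutive _)) (cong not (trans (sym (eq u)) q)) , r))

  transfer : ∀ ψ → depth ψ ≤ 2 → G ⊨ ∃X ψ → H ⊨ ∃X ψ
  transfer ψ le (X , h) with reply X
  ... | Q , m = tabulate Q , proj₁ (Game.sim⇒⇔ G H X (tabulate Q) 2 ψ le
    (match⇒sim G H X (tabulate Q) (match-≗ {G} {H} {lookup X} {Q} (λ w → sym (lookup∘tabulate Q w)) m))) h

-- Pigeonhole, codes of functions and generic relations

avoid : ∀ {w} (L : List (Fin w)) → length L < w → ∃[ e ] e ∉ L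
avoid {w} L len with any? (λ e → ¬? (DecMem._∈?_ _≟_ e L))
... | yes p = p
-- Positions in `L` would inject `Fin w` into a smaller set.
... | no none = contradiction (injective⇒≤ {f = pos} inj) (<⇒≱ len)
  where
  mem : ∀ e → e ∈ L
  mem e = decidable-stable (DecMem._∈?_ _≟_ e L) λ n → none (e , n)
  pos : Fin w → Fin (length L)
  pos e = Any.index (mem e)
  inj : ∀ {e e′} → pos e ≡ pos e′ → e ≡ e′
  inj {e} {e′} eq = trans (lookup-index (mem e))
    (trans (cong (List.lookup L) eq) (sym (lookup-index (mem e′))))

funToFin-cong : ∀ {m n} {f f′ : Fin m → Fin n} → f ≗ f′ → funToFin f ≡ funToFin f′
funToFin-cong {zero}  eq = refl
funToFin-cong {suc m} eq = cong₂ combine (eq zero) (funToFin-cong (eq ∘ suc))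

-- The family `f` may repeat vertices. The demands `t` are made on vertices and not on indices, so
-- repetitions cannot conflict.
record Generic (N : ℕ) (Λ : Set) : Set where
  field
    size    : ℕ
    v₀      : Fin size
    label   : Fin size → Λ
    g       : Fin size → Fin size → Bool
    g-sym   : ∀ x y → g x y ≡ g y x
    extend  : ∀ (f : Fin N → Fin size) (t : Fin size → Bool) l →
              ∃[ z ] label z ≡ l × (∀ i → z ≢ f i × g z (f i) ≡ t (f i))

-- A generic relation

module Construction (N ℓ : ℕ) where

  -- `w` is one more than the number of copies that a new vertex must avoid, `K` counts the outcomes
  -- of `N * N` binary tests, and `n` is the number of slots.
  w K n : ℕ
  w = suc (N + N * (N * N))
  K = 2 ^ (N * N)
  n = (N * N) + ((N * N) + (1 + (1 + (suc ℓ + w * K))))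

  -- A vertex is a function Slot → Slot. Its slots `at ij` and `val ij` hold the
  -- test "is slot p equal to q?" applied to other vertices, `copy` tells which
  -- copy e of the table `cell e k` is in use, and `mark` holds the label.
  Slot : Set
  Slot = Fin (N * N) ⊎ (Fin (N * N) ⊎ (⊤ ⊎ (⊤ ⊎ (Fin (suc ℓ) ⊎ (Fin w × Fin K)))))

  pattern at i     = inj₁ i
  pattern val i    = inj₂ (inj₁ i)
  pattern copy     = inj₂ (inj₂ (inj₁ tt))
  pattern mark     = inj₂ (inj₂ (inj₂ (inj₁ tt)))
  pattern tag l    = inj₂ (inj₂ (inj₂ (inj₂ (inj₁ l))))
  pattern cell e k = inj₂ (inj₂ (inj₂ (inj₂ (inj₂ (e , k)))))

  Slot↔ : Fin n ↔ Slot
  Slot↔ = (↔-id _ ⊎-↔ ((↔-id _ ⊎-↔ ((1↔⊤ ⊎-↔ ((1↔⊤ ⊎-↔ ((↔-id _ ⊎-↔ *↔×) ↔-∘ +↔⊎)) ↔-∘ +↔⊎)) ↔-∘ +↔⊎)) ↔-∘ +↔⊎)) ↔-∘ +↔⊎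

  abstract
    dec : Fin n → Slot
    dec = Inverse.to Slot↔
    enc : Slot → Fin n
    enc = Inverse.from Slot↔
    dec-enc : ∀ p → dec (enc p) ≡ p
    dec-enc = Inverse.strictlyInverseˡ Slot↔
    enc-dec : ∀ i → enc (dec i) ≡ i
    enc-dec = Inverse.strictlyInverseʳ Slot↔

  enc-injective : ∀ {p q} → enc p ≡ enc q → p ≡ q
  enc-injective {p} {q} eq = trans (sym (dec-enc p)) (trans (cong dec eq) (dec-enc q))

  _≟ˢ_ : (p q : Slot) → Dec (p ≡ q)
  p ≟ˢ q = map′ enc-injective (cong enc) (enc p ≟ enc q)

  V : Set
  V = Fin (n ^ n)

  abstract
    h : V → Slot → Slot
    h v p = dec (finToFun v (enc p))

    mk : (Slot → Slot) → V
    mk f = funToFin (enc ∘ f ∘ dec)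

    h-mk : ∀ f p → h (mk f) p ≡ f p
    h-mk f p = trans (cong dec (finToFun-funToFin (enc ∘ f ∘ dec) (enc p)))
      (trans (dec-enc _) (cong f (dec-enc p)))

    differ : ∀ {v v′} → v ≢ v′ → ∃[ p ] h v p ≢ h v′ p
    differ {v} {v′} v≢v′ with any? (λ i → ¬? (finToFun {n} {n} v i ≟ finToFun v′ i))
    ... | yes (i , ne) = dec i , λ eq → ne (trans (cong (finToFun v) (sym (enc-dec i)))
      (trans (trans (sym (enc-dec _)) (trans (cong enc eq) (enc-dec _))) (cong (finToFun v′) (enc-dec i))))
    ... | no none = contradiction
      (trans (sym (funToFin-finToFin {n} {n} v))
        (trans (funToFin-cong (λ i → decidable-stable (_ ≟ _) λ ne → none (i , ne))) (funToFin-finToFin {n} {n} v′)))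
      v≢v′

  -- Cells hold slots like all other entries, so a Boolean is stored as one of two fixed slots.
  bit : Slot → Bool
  bit copy = true
  bit _    = false

  fromBit : Bool → Slot
  fromBit true  = copy
  fromBit false = mark

  bit-fromBit : ∀ b → bit (fromBit b) ≡ b
  bit-fromBit true  = refl
  bit-fromBit false = refl

  copyIn : Slot → Fin w
  copyIn (cell e _) = e
  copyIn _          = zero

  labelIn : Slot → Fin (suc ℓ)
  labelIn (tag l) = l
  labelIn _       = zero

  copyOf : V → Fin w
  copyOf v = copyIn (h v copy)

  labelOf : V → Fin (suc ℓ)
  labelOf v = labelIn (h v mark)

  toFin : Bool → Fin 2
  toFin true  = 1F
  toFin false = 0F

  test : V → Slot → Slot → Fin 2
  test y p q = toFin (does (h y p ≟ˢ q))

  -- The tests come from `x`, so `y` is inspected only at the slots that `x` names.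
  view : V → V → Fin K
  view x y = funToFin λ ij → test y (h x (at ij)) (h x (val ij))

  half : V → V → Bool
  half x y = bit (h x (cell (copyOf x) (view x y)))

  module Extend (f : Fin N → V) (t : V → Bool) (l : Fin (suc ℓ)) where

    -- The copies in use by the family are avoided to make `z` differ from its members, and the
    -- copies that their tests inspect to make their view of `z` independent of its table.
    forbidden : List (Fin w)
    forbidden = List.tabulate (copyOf ∘ f) ++ List.tabulate {n = N * (N * N)} λ q →
      let i , ij = remQuot {N} (N * N) q in copyIn (h (f i) (at ij))

    fresh : ∃[ e ] e ∉ forbidden
    fresh = avoid forbidden (s≤s (subst (_≤ N + N * (N * N)) (sym (trans
      (length-++ (List.tabulate (copyOf ∘ f))) (cong₂ _+_ (length-tabulate (copyOf ∘ f)) (length-tabulate _)))) ≤-refl))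

    e : Fin w
    e = proj₁ fresh

    e≢copy : ∀ i → e ≢ copyOf (f i)
    e≢copy i eq = proj₂ fresh (subst (_∈ forbidden) (sym eq) (∈-++⁺ˡ (∈-tabulate⁺ {f = copyOf ∘ f} i)))

    e≢view : ∀ i ij → copyIn (h (f i) (at ij)) ≢ e
    e≢view i ij eq = proj₂ fresh (subst (_∈ forbidden)
      (trans (cong (λ (i , ij) → copyIn (h (f i) (at ij))) (remQuot-combine {N} {N * N} i ij)) eq)
      (∈-++⁺ʳ (List.tabulate (copyOf ∘ f)) (∈-tabulate⁺ (combine i ij))))

    abstract
      sep : Fin N → Fin N → Slot
      sep i j with f i ≟ f j
      -- Equal vertices call for no separation, so any slot will do.
      ... | yes _ = copy
      ... | no ne = proj₁ (differ ne)

      sep-≢ : ∀ i j → f i ≢ f j → h (f i) (sep i j) ≢ h (f j) (sep i j)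
      sep-≢ i j ne with f i ≟ f j
      ... | yes eq = contradiction eq ne
      ... | no ne′ = proj₂ (differ ne′)

    place what : Fin (N * N) → Slot
    place ij = let i , j = remQuot {N} N ij in sep i j
    what ij = let i , j = remQuot {N} N ij in h (f i) (sep i j)

    code : V → Fin K
    code y = funToFin λ ij → test y (place ij) (what ij)

    -- Test number `(i , j)` asks for the value of `f i` at a slot where `f i` and `f j` differ, so
    -- distinct members answer it differently.
    code-injective : ∀ i j → code (f i) ≡ code (f j) → f i ≡ f j
    code-injective i j eq = decidable-stable (f i ≟ f j) λ ne → impossible ne
      where
      outcome : V → Fin 2
      outcome y = test y (sep i j) (h (f i) (sep i j))
      outcome≡ : ∀ y → finToFun (code y) (combine i j) ≡ outcome y
      outcome≡ y = trans (finToFun-funToFin (λ ij → test y (place ij) (what ij)) (combine i j))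
        (cong (λ (i , j) → test y (sep i j) (h (f i) (sep i j))) (remQuot-combine {N} {N} i j))
      impossible : ¬ f i ≢ f j
      impossible ne with trans (sym (outcome≡ (f i))) (trans (cong (λ c → finToFun c (combine i j)) eq) (outcome≡ (f j)))
      ... | eq′ rewrite dec-true (h (f i) (sep i j) ≟ˢ h (f i) (sep i j)) refl
                      | dec-false (h (f j) (sep i j) ≟ˢ h (f i) (sep i j)) (sep-≢ i j ne ∘ sym) with eq′
      ... | ()

    zfun : (Fin K → Bool) → Slot → Slot
    zfun b (at ij)     = place ij
    zfun b (val ij)    = what ij
    -- Only `e` is ever decoded from this slot. The second component is an arbitrary element of
    -- `Fin K`.
    zfun b copy        = cell e (code (mk id))
    zfun b mark        = tag l
    zfun b (tag _)     = mark
    zfun b (cell e′ k) = if does (e′ ≟ e) then fromBit (b k) else mark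

    agree : ∀ b b′ p → copyIn p ≢ e → zfun b p ≡ zfun b′ p
    agree b b′ (at _)     ne = refl
    agree b b′ (val _)    ne = refl
    agree b b′ copy       ne = refl
    agree b b′ mark       ne = refl
    agree b b′ (tag _)    ne = refl
    agree b b′ (cell e′ k) ne rewrite dec-false (e′ ≟ e) ne = refl

    -- The table of `z` must compensate for what each `f i` contributes, and that contribution
    -- refers to `z`. The provisional vertex with a blank table breaks the circle, because the
    -- contribution is the same for both.
    z₀ : V
    z₀ = mk (zfun λ _ → false)

    b : Fin K → Bool
    b k with any? (λ i → code (f i) ≟ k)
    ... | yes (i , _) = t (f i) xor half (f i) z₀
    ... | no _        = false

    -- The index found may differ from `i`, but equal codes force equal vertices and the required
    -- entry depends on the vertex alone.
    b-code : ∀ i → b (code (f i)) ≡ t (f i) xor half (f i) z₀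
    b-code i with any? (λ j → code (f j) ≟ code (f i))
    ... | yes (j , eq) = cong (λ y → t y xor half y z₀) (code-injective j i eq)
    ... | no none      = contradiction (i , refl) none

    z : V
    z = mk (zfun b)

    z-copy : copyOf z ≡ e
    z-copy = cong copyIn (h-mk (zfun b) copy)

    z-label : labelOf z ≡ l
    z-label = cong labelIn (h-mk (zfun b) mark)

    z-view : ∀ y → view z y ≡ code y
    z-view y = funToFin-cong λ ij → cong₂ (test y) (h-mk (zfun b) (at ij)) (h-mk (zfun b) (val ij))

    half-z : ∀ i → half z (f i) ≡ t (f i) xor half (f i) z₀
    half-z i = begin
      bit (h z (cell (copyOf z) (view z (f i)))) ≡⟨ cong₂ (λ e k → bit (h z (cell e k))) z-copy (z-view (f i)) ⟩
      bit (h z (cell e (code (f i))))            ≡⟨ cong bit (h-mk (zfun b) _) ⟩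
      bit (zfun b (cell e (code (f i))))         ≡⟨ cong (λ c → bit (if c then fromBit (b (code (f i))) else mark)) (dec-true (e ≟ e) refl) ⟩
      bit (fromBit (b (code (f i))))             ≡⟨ bit-fromBit _ ⟩
      b (code (f i))                             ≡⟨ b-code i ⟩
      t (f i) xor half (f i) z₀                  ∎
      where open ≡-Reasoning

    -- The tests of `f i` read no cell of copy `e`, and outside that copy `z` and `z₀` agree.
    half-f : ∀ i → half (f i) z ≡ half (f i) z₀
    half-f i = cong (λ k → bit (h (f i) (cell (copyOf (f i)) k))) (funToFin-cong λ ij →
      cong (λ s → toFin (does (s ≟ˢ h (f i) (val ij))))
        (trans (h-mk (zfun b) _) (trans (agree b _ (h (f i) (at ij)) (e≢view i ij)) (sym (h-mk (zfun λ _ → false) _)))))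

    correct : ∀ i → z ≢ f i × half z (f i) xor half (f i) z ≡ t (f i)
    correct i = (λ eq → e≢copy i (trans (sym z-copy) (cong copyOf eq))) , (begin
      half z (f i) xor half (f i) z                       ≡⟨ cong₂ _xor_ (half-z i) (half-f i) ⟩
      (t (f i) xor half (f i) z₀) xor half (f i) z₀       ≡⟨ xor-assoc (t (f i)) _ _ ⟩
      t (f i) xor (half (f i) z₀ xor half (f i) z₀)       ≡⟨ cong (t (f i) xor_) (xor-same (half (f i) z₀)) ⟩
      t (f i) xor false                                   ≡⟨ xor-identityʳ _ ⟩
      t (f i)                                             ∎)
      where open ≡-Reasoning

generic : ∀ N ℓ → Generic N (Fin (suc ℓ))
generic N ℓ = record
  { size   = n ^ n
  ; v₀     = mk id
  ; label  = labelOf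
  ; g      = λ x y → half x y xor half y x
  ; g-sym  = λ x y → xor-comm (half x y) (half y x)
  ; extend = λ f t l → let open Extend f t l in z , z-label , correct
  }
  where open Construction N ℓ

-- Subsets as lists and as families

elements : ∀ {n} → Subset n → List (Fin n)
elements []            = []
elements (inside  ∷ S) = zero ∷ map suc (elements S)
elements (outside ∷ S) = map suc (elements S)

length-elements : ∀ {n} (S : Subset n) → length (elements S) ≡ ∣ S ∣
length-elements []            = refl
length-elements (inside  ∷ S) = cong suc (trans (length-map suc (elements S)) (length-elements S))
length-elements (outside ∷ S) = trans (length-map suc (elements S)) (length-elements S)

∈-elements : ∀ {n} {S : Subset n} {x} → x ∈ˢ S → x ∈ elements S
∈-elements {S = inside  ∷ S} here      = here refl
∈-elements {S = inside  ∷ S} (there p) = there (∈-map⁺ suc (∈-elements p))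
∈-elements {S = outside ∷ S} (there p) = ∈-map⁺ suc (∈-elements p)

-- A short list becomes a family of fixed length by repeating `a` at the end.
family : ∀ {A : Set} → A → List A → ∀ N → Fin N → A
family a []       N       i       = a
family a (x ∷ xs) (suc N) zero    = x
family a (x ∷ xs) (suc N) (suc i) = family a xs N i

∈-family : ∀ {A : Set} {a : A} {xs x} N → length xs ≤ N → x ∈ xs → ∃[ i ] family a xs N i ≡ x
∈-family (suc N) (s≤s le) (here refl) = zero , refl
∈-family (suc N) (s≤s le) (there p) = let i , eq = ∈-family N le p in suc i , eq

module _ {G : Graph} {P Q : Vertex G → Bool} (eq : ∀ x → P x ≡ Q x) where

  clique-≗ : ∀ {d} → Clique G d P → Clique G d Q
  clique-≗ c p q = c (trans (eq _) p) (trans (eq _) q)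

  out-≗ : ∀ {e} → Out G e P → Out G e Q
  out-≗ (z , z∉ , all) = z , trans (sym (eq z)) z∉ , λ x x∈ → all x (trans (eq x) x∈)

-- Coloured graphs over a generic relation

module Colours (k : ℕ) where

  -- The Boolean splits the colours into two sides of equal size. Index zero gets a special role in
  -- two of the five models.
  Colour : Set
  Colour = Bool × Fin k

  _≟ᶜ_ : (c c′ : Colour) → Dec (c ≡ c′)
  _≟ᶜ_ = ≡-dec Bool._≟_ _≟_

  colours : Fin (2 * k) ↔ Colour
  colours = (2↔Bool ×-↔ ↔-id _) ↔-∘ *↔×

  swap : Colour → Colour
  swap (b , i) = not b , i

  swap-swap : ∀ c → swap (swap c) ≡ c
  swap-swap (b , i) = cong (_, i) (not-involutive b)

  Opposite : Colour → Colour → Set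
  Opposite c p = proj₁ p ≡ not (proj₁ c)

  opposite? : ∀ c p → Dec (Opposite c p)
  opposite? c p = proj₁ p Bool.≟ not (proj₁ c)

  opposite⇒≢ : ∀ {c p} → Opposite c p → c ≢ p
  opposite⇒≢ o refl = not-¬ refl o

  labels : Fin ((2 * k) * (2 * k)) ↔ (Colour × Colour)
  labels = (colours ×-↔ colours) ↔-∘ *↔×

relabel : ∀ {N} {Λ M : Set} → Λ ↔ M → Generic N Λ → Generic N M
relabel i γ = record
  { size = size ; v₀ = v₀ ; label = Inverse.to i ∘ label ; g = g ; g-sym = g-sym
  ; extend = λ f t m → let z , eq , r = extend f t (Inverse.from i m)
                       in z , trans (cong (Inverse.to i) eq) (Inverse.strictlyInverseˡ i m) , r }
  where open Generic γ

module Template (s : ℕ) where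

  k : ℕ
  k = suc (suc (suc (s + s)))

  open Colours k public

  -- `rich` supplies, for each nonzero `i`, an allowed pair whose two colours both have index `i`.
  -- The extension property rests on these pairs.
  module Coloured (Allowed : Colour → Colour → Set) (allowed? : ∀ c p → Dec (Allowed c p))
    (default : ∀ c → ∃ (Allowed c))
    (rich : ∀ i → i ≢ 0F → ∃[ b ] Allowed (false , i) (b , i))
    (γ : Generic (2 * k) (Colour × Colour)) where

    open Generic γ using (size; v₀; label; g; g-sym)

    V : Set
    V = Fin size

    -- A label that is not allowed has its second colour replaced by a default. Every vertex then
    -- obeys the restriction, while every allowed pair still occurs generically.
    col π : V → Colour
    col v = proj₁ (label v)
    π v = let c , p = label v in if does (allowed? c p) then p else proj₁ (default c)

    abstract
      allowed : ∀ v → Allowed (col v) (π v)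
      allowed v with allowed? (proj₁ (label v)) (proj₂ (label v))
      ... | yes a = a
      ... | no _ = proj₂ (default (proj₁ (label v)))

      extendTo : (f : Fin (2 * k) → V) (t : V → Bool) → ∀ {c p} → Allowed c p →
                 ∃[ z ] col z ≡ c × π z ≡ p × (∀ i → z ≢ f i × g z (f i) ≡ t (f i))
      extendTo f t {c} {p} a with Generic.extend γ f t (c , p)
      ... | z , eq , r = z , cong proj₁ eq , π≡ , r
        where
        π≡ : π z ≡ p
        π≡ rewrite eq | dec-true (allowed? c p) a = refl

    Edge : V → V → Set
    Edge x y = col x ≢ col y × (π x ≡ col y ⊎ (π y ≡ col x ⊎ g x y ≡ true))

    abstract
      edge? : ∀ x y → Dec (Edge x y)
      edge? x y = ¬? (col x ≟ᶜ col y) ×-dec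
        (π x ≟ᶜ col y ⊎-dec (π y ≟ᶜ col x ⊎-dec g x y Bool.≟ true))

    edge-sym : ∀ {x y} → Edge x y → Edge y x
    edge-sym (n , inj₁ e) = n ∘ sym , inj₂ (inj₁ e)
    edge-sym (n , inj₂ (inj₁ e)) = n ∘ sym , inj₁ e
    edge-sym (n , inj₂ (inj₂ e)) = n ∘ sym , inj₂ (inj₂ (trans (g-sym _ _) e))

    -- For `d` equal to `false` this is the complementary graph, whose independent sets are the
    -- cliques of the original.
    module Polarised (d : Bool) where

      value : ∀ {A B : Set} → Dec A → Dec B → Bool
      value (yes _) _       = false
      value (no _)  (yes _) = d
      value (no _)  (no _)  = not d

      graph : Graph
      graph = record
        { order  = size
        ; adj    = λ x y → value (x ≟ y) (edge? x y)
        ; symm   = λ x y → value-sym (x ≟ y) (y ≟ x) (edge? x y) (edge? y x)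
        ; irrefl = λ x → value-refl (x ≟ x) (edge? x x)
        }
        where
        value-sym : ∀ {x y} (p : Dec (x ≡ y)) (q : Dec (y ≡ x)) (r : Dec (Edge x y)) (t : Dec (Edge y x)) →
                    value p r ≡ value q t
        value-sym (yes _) (yes _) _ _ = refl
        value-sym (yes p) (no q) _ _ = contradiction (sym p) q
        value-sym (no p) (yes q) _ _ = contradiction (sym q) p
        value-sym (no _) (no _) (yes _) (yes _) = refl
        value-sym (no _) (no _) (yes r) (no t) = contradiction (edge-sym r) t
        value-sym (no _) (no _) (no r) (yes t) = contradiction (edge-sym t) r
        value-sym (no _) (no _) (no _) (no _) = refl
        value-refl : ∀ {x} (p : Dec (x ≡ x)) (r : Dec (Edge x x)) → value p r ≡ false
        value-refl (yes _) _ = refl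
        value-refl (no n) _ = contradiction refl n

      abstract
        edge⇒adj : ∀ {x y} → x ≢ y → Edge x y → adj graph x y ≡ d
        edge⇒adj {x} {y} n e with x ≟ y | edge? x y
        ... | yes p | _ = contradiction p n
        ... | no _ | yes _ = refl
        ... | no _ | no ¬e = contradiction e ¬e

        ¬edge⇒adj : ∀ {x y} → x ≢ y → ¬ Edge x y → adj graph x y ≡ not d
        ¬edge⇒adj {x} {y} n ¬e with x ≟ y | edge? x y
        ... | yes p | _ = contradiction p n
        ... | no _ | yes e = contradiction e ¬e
        ... | no _ | no _ = refl

      adj⇒edge : ∀ {x y} → x ≢ y → adj graph x y ≡ d → Edge x y
      adj⇒edge {x} {y} n eq = decidable-stable (edge? x y) λ ¬e → clash eq (¬edge⇒adj n ¬e)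

      -- The new vertex takes its colour and its `π` from an index that no colour or `π` of a vertex
      -- of `S` uses, so `g` alone decides its adjacency to `S`.
      extension : ExtensionProperty s graph
      extension = s≤size , ext
        where
        s≤k : s ≤ k
        s≤k = ≤-trans (m≤m+n s s) (≤-trans (n≤1+n _) (≤-trans (n≤1+n _) (n≤1+n _)))
        s≤size : s ≤ size
        -- Every colour occurs, so there are at least `k` vertices.
        s≤size = ≤-trans s≤k (injective⇒≤ {f = rep} inj)
          where
          choice : ∀ i → ∃[ z ] col z ≡ (false , i)
          choice i = let z , c , _ = extendTo (λ _ → v₀) (λ _ → true) (proj₂ (default (false , i))) in z , c
          rep : Fin k → V
          rep i = proj₁ (choice i)
          inj : ∀ {i j} → rep i ≡ rep j → i ≡ j
          inj {i} {j} eq = cong proj₂ (trans (sym (proj₂ (choice i))) (trans (cong col eq) (proj₂ (choice j))))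

        ext : ∀ (S : Subset size) → ∣ S ∣ ≡ s → ∀ (T : Subset size) → T ⊆ S →
              ∃[ z ] ¬ (z ∈ˢ S) × (∀ x → x ∈ˢ T → Graph._~_ graph z x)
                   × (∀ x → x ∈ˢ S → ¬ (x ∈ˢ T) → ¬ Graph._~_ graph z x)
        ext S size-S T T⊆S
          with avoid (0F ∷ map (proj₂ ∘ col) (elements S) ++ map (proj₂ ∘ π) (elements S)) short
          where
          len : length (elements S) ≡ s
          len = trans (length-elements S) size-S
          short : suc (length (map (proj₂ ∘ col) (elements S) ++ map (proj₂ ∘ π) (elements S))) < k
          short = s≤s (s≤s (≤-trans (≤-reflexive (trans (length-++ (map (proj₂ ∘ col) (elements S)))
            (cong₂ _+_ (trans (length-map _ (elements S)) len) (trans (length-map _ (elements S)) len)))) (n≤1+n _)))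
        ... | i , i∉ with rich i (i∉ ∘ here)
        -- `m xor not d` is true exactly when `m` equals `d`, that is, when an `Edge` is wanted.
        ...   | b , a with extendTo (family v₀ (elements S) (2 * k)) (λ x → lookup T x xor not d) a
        ...     | z , cz , pz , h = z , (λ z∈ → proj₁ (near z∈) refl) ,
          (λ x x∈ → ≡⇒T (trans (proj₂ (near (T⊆S x∈))) (∈ˢ⇒≡ x∈))) ,
          (λ x x∈ x∉ → ≡⇒¬T (trans (proj₂ (near x∈)) (∉ˢ⇒≡ x∉)))
          where
          ∉cols : ∀ {x} → x ∈ˢ S → proj₂ (col x) ≢ i
          ∉cols x∈ refl = i∉ (there (∈-++⁺ˡ (∈-map⁺ (proj₂ ∘ col) (∈-elements x∈))))
          ∉πs : ∀ {x} → x ∈ˢ S → proj₂ (π x) ≢ i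
          ∉πs x∈ refl = i∉ (there (∈-++⁺ʳ (map (proj₂ ∘ col) (elements S)) (∈-map⁺ (proj₂ ∘ π) (∈-elements x∈))))
          fromG : ∀ {x} m → x ∈ˢ S → z ≢ x → g z x ≡ m xor not d → adj graph z x ≡ m
          fromG {x} m x∈ z≢x eq = byValue (g z x) refl eq
            where
            edge : g z x ≡ true → Edge z x
            edge gz = (λ e → ∉cols x∈ (cong proj₂ (trans (sym e) cz))) , inj₂ (inj₂ gz)
            ¬edge : g z x ≡ false → ¬ Edge z x
            ¬edge gz (_ , inj₁ e) = ∉cols x∈ (cong proj₂ (trans (sym e) pz))
            ¬edge gz (_ , inj₂ (inj₁ e)) = ∉πs x∈ (cong proj₂ (trans e cz))
            ¬edge gz (_ , inj₂ (inj₂ e)) = clash e gz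
            d≡ : ∀ m d → true ≡ m xor not d → d ≡ m
            d≡ true  true  _ = refl
            d≡ false false _ = refl
            not-d≡ : ∀ m d → false ≡ m xor not d → not d ≡ m
            not-d≡ true  false _ = refl
            not-d≡ false true  _ = refl
            byValue : ∀ b → g z x ≡ b → b ≡ m xor not d → adj graph z x ≡ m
            byValue true  gz eq = trans (edge⇒adj z≢x (edge gz)) (d≡ m d eq)
            byValue false gz eq = trans (¬edge⇒adj z≢x (¬edge gz)) (not-d≡ m d eq)
          near : ∀ {x} → x ∈ˢ S → z ≢ x × adj graph z x ≡ lookup T x
          near {x} x∈ with ∈-family {a = v₀} (2 * k)
            (≤-trans (≤-reflexive (trans (length-elements S) size-S)) (≤-trans s≤k (m≤m+n k (k + 0)))) (∈-elements x∈)
          ... | j , refl = proj₁ (h j) , fromG _ x∈ (proj₁ (h j)) (proj₂ (h j))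

      Has : (V → Bool) → Colour → Set
      Has P c = ∃[ x ] P x ≡ true × col x ≡ c

      has? : ∀ P c → Dec (Has P c)
      has? P c = any? λ x → P x Bool.≟ true ×-dec col x ≟ᶜ c

      module _ {P : V → Bool} (cl : Clique graph d P) where

        col-injective : ∀ {x y} → P x ≡ true → P y ≡ true → col x ≡ col y → x ≡ y
        col-injective {x} {y} p q eq =
          decidable-stable (x ≟ y) λ n → proj₁ (adj⇒edge n (cl p q n)) eq

        rep : Colour → V
        rep c with has? P c
        ... | yes (x , _) = x
        ... | no _        = v₀

        rep-col : ∀ {x} → P x ≡ true → rep (col x) ≡ x
        rep-col {x} p with has? P (col x)
        ... | yes (y , q , eq) = col-injective q p eq
        ... | no none          = contradiction (x , p , refl) none

        -- A clique has at most one vertex of each colour, so the `2 * k` colours enumerate it and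
        -- genericity applies to the whole clique at once.
        extendClique : (t : V → Bool) → ∀ {c p} → Allowed c p →
          ∃[ z ] col z ≡ c × π z ≡ p × P z ≡ false × (∀ x → P x ≡ true → z ≢ x × g z x ≡ t x)
        extendClique t a with extendTo (rep ∘ Inverse.to colours) t a
        ... | z , cz , pz , h = z , cz , pz , z∉ , toAll
          where
          toAll : ∀ x → P x ≡ true → z ≢ x × g z x ≡ t x
          toAll x p = subst (λ y → z ≢ y × g z y ≡ t y)
            (trans (cong rep (Inverse.strictlyInverseˡ colours (col x))) (rep-col p))
            (h (Inverse.from colours (col x)))
          z∉ : P z ≡ false
          z∉ with P z in eq
          ... | false = refl
          ... | true  = contradiction refl (proj₁ (toAll z eq))

        -- A new vertex of the missing colour, joined by `g` to the whole clique, extends it.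
        missing⇒out : ∀ {c} → ¬ Has P c → Out graph d P
        missing⇒out {c} none with extendClique (λ _ → true) (proj₂ (default c))
        ... | z , cz , _ , z∉ , h = z , z∉ , λ x p →
          edge⇒adj (proj₁ (h x p)) ((λ eq → none (x , p , trans (sym eq) cz)) , inj₂ (inj₂ (proj₂ (h x p))))

        -- When `g` is false towards the clique, only `π` could create an edge, and the hypothesis
        -- excludes that.
        undominated : ∀ {c p} → Allowed c p →
          (∀ x → P x ≡ true → col x ≢ c → p ≢ col x × π x ≢ c) → Out graph (not d) P
        undominated a far with extendClique (λ _ → false) a
        ... | z , refl , refl , z∉ , h = z , z∉ , λ x p → ¬edge⇒adj (proj₁ (h x p)) λ
          { (n , inj₁ e) → proj₁ (far x p (n ∘ sym)) e
          ; (n , inj₂ (inj₁ e)) → proj₂ (far x p (n ∘ sym)) e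
          ; (n , inj₂ (inj₂ e)) → clash e (proj₂ (h x p)) }

        hit? : ∀ b j → Dec (∃[ x ] P x ≡ true × proj₁ (col x) ≡ b × π x ≡ (not b , j))
        hit? b j = any? λ x → P x Bool.≟ true ×-dec (proj₁ (col x) Bool.≟ b ×-dec π x ≟ᶜ (not b , j))

        -- The vertices of P on the side of a missing colour are fewer than
        -- the colours of the other side, so their π miss one of these.
        offSide : (∀ x → π x ≡ col x ⊎ Opposite (col x) (π x)) → ∀ {b i} → ¬ Has P (b , i) →
          ∃[ j ] (∀ x → P x ≡ true → col x ≢ (not b , j) → π x ≢ (not b , j))
        offSide sided {b} {i} none
          with any? (λ j → ¬? (hit? b j))
        ... | yes (j , free) = j , λ x p n eq → case sided x of λ
          { (inj₁ own) → n (trans (sym own) eq)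
          ; (inj₂ opp) → free (x , p , not-injective (trans (sym opp) (cong proj₁ eq)) , eq) }
        ... | no all = contradiction (injective⇒≤ {f = F} F-injective) 1+n≰n
          where
          hit : ∀ j → ∃[ x ] P x ≡ true × proj₁ (col x) ≡ b × π x ≡ (not b , j)
          hit j = decidable-stable (hit? b j) λ n → all (j , n)
          hit-col : ∀ j → col (proj₁ (hit j)) ≡ (b , proj₂ (col (proj₁ (hit j))))
          hit-col j = cong (_, proj₂ (col (proj₁ (hit j)))) (proj₁ (proj₂ (proj₂ (hit j))))
          F : Fin (suc k) → Fin k
          F zero    = i
          F (suc j) = proj₂ (col (proj₁ (hit j)))
          avoids : ∀ j → i ≢ F (suc j)
          avoids j eq = none (proj₁ (hit j) , proj₁ (proj₂ (hit j)) , trans (hit-col j) (cong (b ,_) (sym eq)))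
          F-injective : ∀ {j j′} → F j ≡ F j′ → j ≡ j′
          F-injective {zero}  {zero}   _  = refl
          F-injective {zero}  {suc j}  eq = contradiction eq (avoids j)
          F-injective {suc j} {zero}   eq = contradiction (sym eq) (avoids j)
          F-injective {suc j} {suc j′} eq = cong suc (cong proj₂ (trans (sym (proj₂ (proj₂ (proj₂ (hit j)))))
            (trans (cong π same) (proj₂ (proj₂ (proj₂ (hit j′)))))))
            where
            same : proj₁ (hit j) ≡ proj₁ (hit j′)
            same = col-injective (proj₁ (proj₂ (hit j))) (proj₁ (proj₂ (hit j′)))
              (trans (hit-col j) (trans (cong (b ,_) eq) (sym (hit-col j′))))

      -- Edges join different colours, so the colour of the outside vertex itself is missing.
      out⇒missing : ∀ {P} → Out graph d P → ∃[ c ] ¬ Has P c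
      out⇒missing (z , z∉ , all) = col z , λ (x , p , eq) →
        proj₁ (adj⇒edge (λ { refl → clash p z∉ }) (all x p)) (sym eq)

      full⇒¬out : ∀ {P} → (∀ c → Has P c) → ¬ Out graph d P
      full⇒¬out has o = let c , none = out⇒missing o in none (has c)

      -- Edges that come from `π` exist whatever `g` is, so it is enough to treat each allowed pair
      -- of colours.
      dominating : ∀ {P} → (∀ {c p} → Allowed c p → ∃[ x ] P x ≡ true × c ≢ col x × (p ≡ col x ⊎ π x ≡ c)) →
                   ¬ Out graph (not d) P
      dominating dom (z , z∉ , all) with dom (allowed z)
      ... | x , p , n , e = clash
        (edge⇒adj (λ { refl → n refl }) (n , Sum.map₂ inj₁ e)) (all x p)

      -- The greedy clique is drawn from the vertices whose pair satisfies `W`. If a colour `c` were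
      -- missing, a new vertex with pair `(c , p)`, joined by `g` to the clique, would have been in
      -- conflict with nothing when scanned.
      transversal : (W : Colour → Colour → Set) → (∀ c p → Dec (W c p)) →
        ∃[ P ] Clique graph d P × (∀ x → P x ≡ true → W (col x) (π x))
             × (∀ {c p} → W c p → Allowed c p → Has P c)
      transversal W W? with greedy {graph} d (filter (λ x → W? (col x) (π x)) (allFin size)) (λ _ → false) (λ ())
      ... | P , cl , _ , down , max = P , cl ,
        (λ x p → [ (λ ()) , (λ i → proj₂ (∈-filter⁻ (λ x → W? (col x) (π x)) {xs = allFin size} i)) ]′ (down x p)) , has
        where
        has : ∀ {c p} → W c p → Allowed c p → Has P c
        has {c} {p} w a = decidable-stable (has? P c) λ none → impossible none
          where
          impossible : ¬ ¬ Has P c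
          impossible none with extendClique cl (λ _ → true) a
          ... | z , refl , refl , z∉ , h with max (∈-filter⁺ (λ x → W? (col x) (π x)) (∈-allFin z) w)
          ...   | inj₁ z∈ = clash z∈ z∉
          ...   | inj₂ (y , y∈ , n , r) = clash
            (edge⇒adj (n ∘ sym) ((λ eq → none (y , y∈ , sym eq)) , inj₂ (inj₂ (proj₂ (h y y∈))))) r

      -- A maximal clique contains every colour. An outside vertex is joined to the member whose
      -- colour is its own `π`, which differs from its own colour by being on the other side.
      oppositeφ² : (∀ {c p} → Allowed c p → Opposite c p) → graph ⊨ φ² d
      oppositeφ² opp = ⊨φ² graph d λ X cl ¬out → dominating λ {c} {p} a →
        let x , x∈ , eq = decidable-stable (has? (lookup X) p) λ none → ¬out (missing⇒out cl none)
        in x , x∈ , (λ e → opposite⇒≢ (opp a) (trans e eq)) , inj₁ (sym eq)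

      -- A non-maximal clique misses a colour `(b , i)`. A new vertex gets a colour on the other
      -- side that is no member's `π`, except possibly that of the member of this colour, and takes
      -- as its `π` that colour or the missing one. It is not dominated.
      sidedφ³ : (∀ {c p} → Allowed c p → p ≡ c ⊎ Opposite c p) →
        (∀ b i j → ∃[ p ] Allowed (not b , j) p × (p ≡ (not b , j) ⊎ p ≡ (b , i))) → graph ⊨ φ³ d
      sidedφ³ sided choice = ⊨φ³ graph d λ X cl ¬dom out →
        let (b , i) , none = out⇒missing out
            j , free = offSide cl (λ x → sided (allowed x)) none
            p , a , e = choice b i j
        in ¬dom (undominated cl a λ x x∈ n →
             (λ q → [ (λ e → n (trans (sym q) e)) , (λ e → none (x , x∈ , trans (sym q) e)) ]′ e) , free x x∈ n)

      -- A non-maximal dominating clique: all colours with nonzero index, each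
      -- vertex with π equal to the swapped colour.
      module _ (nonzero : ∀ {c p} → Allowed c p → proj₂ c ≡ 0F → Opposite c p × proj₂ p ≢ 0F)
               (swaps : ∀ c → proj₂ c ≢ 0F → Allowed c (swap c)) where

        nonmaximalDominating : ∃[ P ] Clique graph d P × ¬ Out graph (not d) P × Out graph d P
        nonmaximalDominating
          with transversal (λ c p → proj₂ c ≢ 0F × p ≡ swap c) (λ c p → ¬? (proj₂ c ≟ 0F) ×-dec p ≟ᶜ swap c)
        ... | P , cl , only , has = P , cl , dominating dom ,
          missing⇒out cl {false , 0F} (λ (x , x∈ , eq) → proj₁ (only x x∈) (cong proj₂ eq))
          where
          dom : ∀ {c p} → Allowed c p → ∃[ x ] P x ≡ true × c ≢ col x × (p ≡ col x ⊎ π x ≡ c)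
          -- A vertex whose colour has index zero reaches the clique through its own `π`. Any other
          -- is reached by the `π` of the member with the swapped colour.
          dom {c} {p} a with proj₂ c ≟ 0F
          ... | yes c0 with nonzero a c0
          ...   | opp , p≢0 with has (p≢0 , refl) (swaps p p≢0)
          ...     | x , x∈ , refl = x , x∈ , opposite⇒≢ opp , inj₁ refl
          dom {c} {p} a | no c≢0 with has {swap c} (c≢0 , refl) (swaps (swap c) c≢0)
          ... | x , x∈ , eq = x , x∈ , (λ e → opposite⇒≢ {c} {swap c} refl (trans e eq)) ,
            inj₂ (trans (proj₂ (only x x∈)) (trans (cong swap eq) (swap-swap c)))

-- The five models

module _ (G : Graph) (d : Bool) (P : Vertex G → Bool) (cl : Clique G d P) where
  private
    tab : ∀ x → P x ≡ lookup (tabulate P) x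
    tab x = sym (lookup∘tabulate P x)
    clT : Clique G d (lookup (tabulate P))
    clT = clique-≗ {G} tab cl

  ⊭φ¹′ : ¬ Out G (not d) P → ¬ (G ⊨ φ¹ d)
  ⊭φ¹′ n = ⊭φ¹ G d (tabulate P) clT (n ∘ out-≗ {G} (sym ∘ tab))

  ⊭φ²′ : ¬ Out G d P → Out G (not d) P → ¬ (G ⊨ φ² d)
  ⊭φ²′ n o = ⊭φ² G d (tabulate P) clT (n ∘ out-≗ {G} (sym ∘ tab)) (out-≗ {G} tab o)

  ⊭φ³′ : ¬ Out G (not d) P → Out G d P → ¬ (G ⊨ φ³ d)
  ⊭φ³′ n o = ⊭φ³ G d (tabulate P) clT (n ∘ out-≗ {G} (sym ∘ tab)) (out-≗ {G} tab o)

module Models (s : ℕ) (d : Bool) where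

  open Template s

  abstract
    γ : Generic (2 * k) (Colour × Colour)
    γ = relabel labels (generic (2 * k) _)

  Model : Sentence → Set
  Model φ = ∃[ G ] ExtensionProperty s G × G ⊨ φ

  -- With `π` equal to the colour, `π` never creates an edge, so no clique dominates.
  model¹ : Model (φ¹ d)
  model¹ = graph , extension , ⊨φ¹ graph d λ X cl →
    undominated cl {false , 0F} refl λ x _ n → n ∘ sym , λ e → n (trans (sym (allowed x)) e)
    where
    open Coloured (λ c p → p ≡ c) (λ c p → p ≟ᶜ c) (λ c → c , refl) (λ i _ → false , refl) γ
    open Polarised d

  -- `π` is the own colour or any colour of the other side. A full transversal with `π` swapped
  -- dominates, one with `π` equal to the colour does not, and every dominating clique is maximal by
  -- `sidedφ³`.
  model² : Model (¬ˢ φ¹ d ∧ˢ ¬ˢ φ² d ∧ˢ φ³ d)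
  model² = graph , extension , refute¹ , refute² ,
    sidedφ³ id (λ b i j → (not b , j) , inj₁ refl , inj₁ refl)
    where
    open Coloured (λ c p → p ≡ c ⊎ Opposite c p) (λ c p → p ≟ᶜ c ⊎-dec opposite? c p)
      (λ c → c , inj₁ refl) (λ i _ → false , inj₁ refl) γ
    open Polarised d
    refute¹ : ¬ (graph ⊨ φ¹ d)
    refute¹ with transversal (λ c p → p ≡ swap c) (λ c p → p ≟ᶜ swap c)
    ... | P , cl , only , has = ⊭φ¹′ graph d P cl (dominating λ {c} _ →
      let x , x∈ , eq = has {swap c} refl (inj₂ refl)
      in x , x∈ , (λ e → opposite⇒≢ {c} {swap c} refl (trans e eq)) ,
         inj₂ (trans (only x x∈) (trans (cong swap eq) (swap-swap c))))
    refute² : ¬ (graph ⊨ φ² d)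
    refute² with transversal (λ c p → p ≡ c) (λ c p → p ≟ᶜ c)
    ... | P , cl , only , has = ⊭φ²′ graph d P cl (full⇒¬out λ c → has {c} refl (inj₁ refl))
      (undominated cl {false , 0F} (inj₁ refl) λ x x∈ n → n ∘ sym , λ e → n (trans (sym (only x x∈)) e))

  -- Here colours of index zero must have their `π` on the other side with nonzero index. A clique
  -- without these colours can then dominate, while a transversal with default `π` still does not.
  model³ : Model (¬ˢ φ¹ d ∧ˢ ¬ˢ φ² d ∧ˢ ¬ˢ φ³ d)
  model³ = let P , cl , dom , out = counter in
    graph , extension , ⊭φ¹′ graph d P cl dom , refute² , ⊭φ³′ graph d P cl dom out
    where
    Allowed : Colour → Colour → Set
    Allowed c p = (p ≡ c ⊎ Opposite c p) × (proj₂ c ≡ 0F → Opposite c p × proj₂ p ≢ 0F)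
    default : ∀ c → ∃ (Allowed c)
    default (b , zero)  = (not b , 1F) , inj₂ refl , λ _ → refl , λ ()
    default (b , suc i) = (b , suc i) , inj₁ refl , λ ()
    open Coloured Allowed
      (λ c p → (p ≟ᶜ c ⊎-dec opposite? c p) ×-dec
               (proj₂ c ≟ 0F →-dec (opposite? c p ×-dec ¬? (proj₂ p ≟ 0F))))
      default (λ i i≢0 → false , inj₁ refl , λ i≡0 → contradiction i≡0 i≢0) γ
    open Polarised d
    counter : ∃[ P ] Clique graph d P × ¬ Out graph (not d) P × Out graph d P
    counter = nonmaximalDominating proj₂ (λ c c≢0 → inj₂ refl , λ c≡0 → contradiction c≡0 c≢0)
    refute² : ¬ (graph ⊨ φ² d)
    refute² with transversal (λ c p → p ≡ proj₁ (default c)) (λ c p → p ≟ᶜ proj₁ (default c))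
    ... | P , cl , only , has = ⊭φ²′ graph d P cl (full⇒¬out λ c → has {c} refl (proj₂ (default c)))
      -- The defaults of index-zero colours use `1F`, so `(false , 2F)` is the default of no colour
      -- but itself.
      (undominated cl {false , 2F} {false , 2F} (inj₁ refl , λ ()) λ x x∈ n → n ∘ sym ,
        λ e → avoids2 (col x) n (trans (sym (only x x∈)) e))
      where
      avoids2 : ∀ c → c ≢ (false , 2F) → proj₁ (default c) ≢ (false , 2F)
      avoids2 (b , zero)  n ()
      avoids2 (b , suc i) n e = n e

  -- `π` always lies on the other side, with no further restriction, so it may take the value of any
  -- missing colour there.
  model⁴ : Model (φ² d ∧ˢ φ³ d)
  model⁴ = graph , extension , oppositeφ² id ,
    sidedφ³ inj₂ (λ b i j → (b , i) , sym (not-involutive b) , inj₂ refl)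
    where
    open Coloured Opposite opposite? (λ c → swap c , refl) (λ i _ → true , refl) γ
    open Polarised d

  -- As in the previous model, but `π` of an index-zero colour has nonzero index, so the index-zero
  -- colours can be left out of a dominating clique.
  model⁵ : Model (φ² d ∧ˢ ¬ˢ φ³ d)
  model⁵ = graph , extension , oppositeφ² proj₁ ,
    (let P , cl , dom , out = nonmaximalDominating (λ (o , n) c≡0 → o , n c≡0)
                                (λ c c≢0 → refl , λ c≡0 → contradiction c≡0 c≢0)
     in ⊭φ³′ graph d P cl dom out)
    where
    Allowed : Colour → Colour → Set
    Allowed c p = Opposite c p × (proj₂ c ≡ 0F → proj₂ p ≢ 0F)
    default : ∀ c → ∃ (Allowed c)
    default (b , zero)  = (not b , 1F) , refl , λ _ ()
    default (b , suc i) = (not b , suc i) , refl , λ ()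
    open Coloured Allowed (λ c p → opposite? c p ×-dec (proj₂ c ≟ 0F →-dec ¬? (proj₂ p ≟ 0F)))
      default (λ i i≢0 → true , refl , λ i≡0 → contradiction i≡0 i≢0) γ
    open Polarised d

  models : ∀ φ → φ ∈ combinations (φ¹ d) (φ² d) (φ³ d) → Model φ
  models _ (here refl) = model¹
  models _ (there (here refl)) = model²
  models _ (there (there (here refl))) = model³
  models _ (there (there (there (here refl)))) = model⁴
  models _ (there (there (there (there (here refl))))) = model⁵

-- Agreement of truth values and the conclusion

sameTruth-sym : ∀ {G H φ} → SameTruth G H φ → SameTruth H G φ
sameTruth-sym = Sum.map Product.swap Product.swap

sameTruth-⊭ : ∀ {G H φ} → SameTruth G H φ → ¬ (G ⊨ φ) → ¬ (H ⊨ φ)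
sameTruth-⊭ (inj₁ (g , _)) ¬g = contradiction g ¬g
sameTruth-⊭ (inj₂ (_ , ¬h)) _ = ¬h

module _ (G H : Graph) (EG : ExtensionProperty 5 G) (EH : ExtensionProperty 5 H)
  (same¹ : ∀ d → SameTruth G H (φ¹ d))
  (same² : ∀ d → SameTruth G H (φ² d))
  (same³ : ∀ d → SameTruth G H (φ³ d)) where

  sameTruth-∃X : ∀ ψ → depth ψ ≤ 2 → SameTruth G H (∃X ψ)
  sameTruth-∃X ψ le with ∃X? G ψ | ∃X? H ψ
  ... | yes g | yes h = inj₁ (g , h)
  ... | no ¬g | no ¬h = inj₂ (¬g , ¬h)
  ... | yes g | no ¬h = contradiction
    (Transfer.transfer G H EG EH
      (λ d → sameTruth-⊭ {G} {H} {φ¹ d} (same¹ d))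
      (λ d → sameTruth-⊭ {G} {H} {φ² d} (same² d))
      (λ d → sameTruth-⊭ {G} {H} {φ³ d} (same³ d)) ψ le g) ¬h
  ... | no ¬g | yes h = contradiction
    (Transfer.transfer H G EH EG
      (λ d → sameTruth-⊭ {H} {G} {φ¹ d} (sameTruth-sym {G} {H} {φ¹ d} (same¹ d)))
      (λ d → sameTruth-⊭ {H} {G} {φ² d} (sameTruth-sym {G} {H} {φ² d} (same² d)))
      (λ d → sameTruth-⊭ {H} {G} {φ³ d} (sameTruth-sym {G} {H} {φ³ d} (same³ d))) ψ le h) ¬g

theorem4 : (∃[ s ] 0 < s ×
    (∀ (G H : Graph) → ExtensionProperty s G → ExtensionProperty s H →
    All (SameTruth G H) (φ¹C ∷ φ²C ∷ φ³C ∷ φ¹I ∷ φ²I ∷ φ³I ∷ []) →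
    ∀ (φ : Sentence) → 𝓔₁² φ → SameTruth G H φ))
    × (∀ (s : ℕ) → 0 < s →
    (∀ (φ : Sentence) → φ ∈ combinations φ¹C φ²C φ³C →
    ∃[ G ] ExtensionProperty s G × G ⊨ φ)
    × (∀ (φ : Sentence) → φ ∈ combinations φ¹I φ²I φ³I →
    ∃[ G ] ExtensionProperty s G × G ⊨ φ))
theorem4 =
  (5 , s≤s z≤n , λ { G H EG EH (c¹ ∷ c² ∷ c³ ∷ i¹ ∷ i² ∷ i³ ∷ []) _ (ψ , refl , depth≡2) →
    sameTruth-∃X G H EG EH
      (λ { true → c¹ ; false → i¹ }) (λ { true → c² ; false → i² }) (λ { true → c³ ; false → i³ })
      ψ (≤-reflexive depth≡2) }) ,
  λ s _ → Models.models s true , Models.models s false
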